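{- Let $m,n$ be positive integers. $J(\mathbf{P}_{m,n})$ under rowmotion and the set of $(m,n)$-partial fully-packed loop configurations under gyration are in equivariant bijection: there is a bijection $\Phi$ from the set of $(m,n)$-partial fully-packed loop configurations to $J(\mathbf{P}_{m,n})$ such that $\Phi(G(F))=\mathrm{Row}(\Phi(F))$ for every configuration $F$.
   Context: The poset $\mathbf{P}_{m,n}$ has elements the integer triples $(i,j,k)$ with $0\le k\le m-1$, $k\le j\le n-1$, $k\le i\le m-1$, and partial order generated by the covering relations: $(i,j,k)$ covers each of $(i+1,j,k)$, $(i,j+1,k)$, $(i-1,j,k-1)$, $(i,j-1,k-1)$ that is an element of $\mathbf{P}_{m,n}$. $J(P)$ is the set of order ideals of $P$. Rowmotion $\mathrm{Row}:J(P)\to J(P)$ sends $X$ to the order ideal generated by the minimal elements of $P\setminus X$. The graph $G_{m,n}$ has vertex set $\{v_{i,j}:0\le i\le m+1,\ 0\le j\le n+1\}\setminus\{v_{0,0},v_{0,n+1},v_{m+1,0},v_{m+1,n+1}\}$ and edges $v_{i,j}v_{i+1,j}$ for $0\le i\le m$, $1\le j\le n$, and $v_{i,j}v_{i,j+1}$ for $1\le i\le m$, $0\le j\le n$ ($i$ indexes rows from the top, $j$ columns from the left). Vertices $v_{i,j}$ with $1\le i\le m$, $1\le j\le n$ are interior. An $(m,n)$-partial fully-packed loop configuration is a subgraph of $G_{m,n}$ (on all vertices) such that every interior vertex has exactly two incident edges, and: for $1\le j\le n$ the edge $v_{0,j}v_{1,j}$ is present iff $j$ is odd, and for $1\le i\le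 m$ the edge $v_{i,0}v_{i,1}$ is present iff $i$ is even. Squares: for $0\le i\le m$, $0\le j\le n$, the square $Q_{i,j}$ has upper-left corner $v_{i,j}$; its sides are top $v_{i,j}v_{i,j+1}$, bottom $v_{i+1,j}v_{i+1,j+1}$, left $v_{i,j}v_{i+1,j}$, right $v_{i,j+1}v_{i+1,j+1}$ (those that are edges of $G_{m,n}$). $Q_{i,j}$ is even if $i+j$ is even, odd otherwise. The local action on $Q_{i,j}$ (for a configuration $F$, looking at which sides of $Q_{i,j}$ are edges of $F$): if $i=0$ or $j=0$ (boundary square), do nothing. If $1\le i\le m-1$, $1\le j\le n-1$ (interior square): if the sides in $F$ are exactly $\{$top, bottom$\}$, replace them by $\{$left, right$\}$, and vice versa. If $1\le i\le m-1$, $j=n$ (right exterior): swap exactly $\{$left$\}$ with exactly $\{$top, bottom$\}$. If $i=m$, $1\le j\le n-1$ (bottom exterior): swap exactly $\{$top$\}$ with exactly $\{$left, right$\}$. If $i=m$, $j=n$: swap exactly $\{$left$\}$ with exactly $\{$top$\}$. In all other cases do nothing. Gyration $G$ applies the local action to all even squares, then to all odd squares; it maps partial fully-packed loop configurations to partial fully-packed loop configurations. -}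

module Defs where

open import Data.Bool.Base using (Bool; true; false; T; if_then_else_; _∧_; _∨_)
open import Data.Bool.Properties using (T?)
open import Data.Fin.Base using (Fin; toℕ; fromℕ<)
import Data.Fin.Properties as Fin
open import Data.List.Base using (List; []; _∷_; length; filter; filterᵇ; foldr; cartesianProductWith; allFin)
open import Data.List.Membership.Propositional using (_∈_)
open import Data.List.Relation.Unary.All using ([]; _∷_)
open import Data.List.Relation.Unary.AllPairs using ([]; _∷_)
open import Data.List.Relation.Unary.Any using (here; there)
open import Data.List.Relation.Unary.Unique.Propositional using (Unique)
open import Data.Nat.Base
open import Data.Nat.Properties
open import Algebra.Properties.CommutativeSemigroup +-commutativeSemigroup using (interchange)
open import Data.Nat.Solver using (module +-*-Solver)
open import Data.Parity.Base using (Parity; 0ℙ; 1ℙ)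
import Data.Parity.Properties as Parity
open import Data.Product.Base using (Σ; ∃; _×_; _,_; proj₁; proj₂)
open import Data.Sum.Base using (_⊎_; inj₁; inj₂)
open import Function.Base using (_∘_)
open import Function.Bundles using (_⇔_; mk⇔)
open import Level using (0ℓ)
open import Relation.Binary.Bundles using (Setoid)
open import Relation.Binary.Construct.Closure.ReflexiveTransitive using (Star; ε; _◅_; _◅◅_)
open import Relation.Binary.PropositionalEquality using (_≡_; _≢_; refl; sym; trans; cong; cong₂; subst; _→-setoid_)
import Relation.Binary.Construct.On as On
open import Relation.Nullary using (Dec; yes; no; ¬_; contradiction)
open import Relation.Nullary.Decidable using (map′; _×-dec_; _⊎-dec_; ¬?; _→-dec_; decidable-stable; isYes; toWitness; fromWitness)
open import Relation.Nullary.Negation using (contradiction-irr)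
open import Relation.Unary using (Pred; Decidable)

private
  variable
    m n : ℕ

record Element (m n : ℕ) : Set where
  constructor element
  field
    i j k : ℕ
    .k<m : k < m
    .k≤j : k ≤ j
    .j<n : j < n
    .k≤i : k ≤ i
    .i<m : i < m

data _covers_ {m n : ℕ} (p q : Element m n) : Set where
  down-i  : let open Element in
            i q ≡ suc (i p) → j q ≡ j p → k q ≡ k p → p covers q
  down-j  : let open Element in
            i q ≡ i p → j q ≡ suc (j p) → k q ≡ k p → p covers q
  down-ik : let open Element in
            i p ≡ suc (i q) → j p ≡ j q → k p ≡ suc (k q) → p covers q
  down-jk : let open Element in
            i p ≡ i q → j p ≡ suc (j q) → k p ≡ suc (k q) → p covers q

_≤ᴾ_ : Element m n → Element m n → Set
q ≤ᴾ p = Star _covers_ p q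

_≟ᴾ_ : (p q : Element m n) → Dec (p ≡ q)
element i j k _ _ _ _ _ ≟ᴾ element i′ j′ k′ _ _ _ _ _ =
  map′ (λ { (refl , refl , refl) → refl }) (λ { refl → refl , refl , refl })
       (i ≟ i′ ×-dec j ≟ j′ ×-dec k ≟ k′)

_covers?_ : (p q : Element m n) → Dec (p covers q)
p covers? q =
  map′ (λ { (inj₁ (a , b , c)) → down-i a b c
          ; (inj₂ (inj₁ (a , b , c))) → down-j a b c
          ; (inj₂ (inj₂ (inj₁ (a , b , c)))) → down-ik a b c
          ; (inj₂ (inj₂ (inj₂ (a , b , c)))) → down-jk a b c })
       (λ { (down-i a b c) → inj₁ (a , b , c)
          ; (down-j a b c) → inj₂ (inj₁ (a , b , c))
          ; (down-ik a b c) → inj₂ (inj₂ (inj₁ (a , b , c)))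
          ; (down-jk a b c) → inj₂ (inj₂ (inj₂ (a , b , c))) })
       (  (i q ≟ suc (i p) ×-dec j q ≟ j p ×-dec k q ≟ k p)
       ⊎-dec (i q ≟ i p ×-dec j q ≟ suc (j p) ×-dec k q ≟ k p)
       ⊎-dec (i p ≟ suc (i q) ×-dec j p ≟ j q ×-dec k p ≟ suc (k q))
       ⊎-dec (i p ≟ i q ×-dec j p ≟ suc (j q) ×-dec k p ≟ suc (k q)))
  where open Element

any-element? : {Q : Pred (Element m n) 0ℓ} → Decidable Q → Dec (∃ Q)
any-element? {m} {n} {Q} Q? =
  map′ to from (Fin.any? λ i → Fin.any? λ j → Fin.any? λ k → at? i j k)
  where
  At : Fin m → Fin n → Fin m → Set
  At i j k = Σ (Element m n) λ p →
    (Element.i p ≡ toℕ i × Element.j p ≡ toℕ j × Element.k p ≡ toℕ k) × Q p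

  at? : ∀ i j k → Dec (At i j k)
  at? i j k with toℕ k ≤? toℕ j | toℕ k ≤? toℕ i
  ... | no k≰j | _ =
    no λ { (element _ _ _ _ k≤j _ _ _ , (refl , refl , refl) , _) → contradiction-irr k≤j k≰j }
  ... | yes _ | no k≰i =
    no λ { (element _ _ _ _ _ _ k≤i _ , (refl , refl , refl) , _) → contradiction-irr k≤i k≰i }
  ... | yes k≤j | yes k≤i =
    map′ (λ q → p , (refl , refl , refl) , q)
         (λ { (element _ _ _ _ _ _ _ _ , (refl , refl , refl) , q) → q })
         (Q? p)
    where
    p : Element m n
    p = element (toℕ i) (toℕ j) (toℕ k) (Fin.toℕ<n k) k≤j (Fin.toℕ<n j) k≤i (Fin.toℕ<n i)

  to : (∃ λ i → ∃ λ j → ∃ λ k → At i j k) → ∃ Q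
  to (_ , _ , _ , p , _ , q) = p , q

  from : ∃ Q → ∃ λ i → ∃ λ j → ∃ λ k → At i j k
  from (p@(element i j k k<m _ j<n _ i<m) , q) =
    fromℕ< (recompute-< i<m) , fromℕ< (recompute-< j<n) , fromℕ< (recompute-< k<m) , p ,
    (sym (Fin.toℕ-fromℕ< _) , sym (Fin.toℕ-fromℕ< _) , sym (Fin.toℕ-fromℕ< _)) , q
    where
    recompute-< : ∀ {a b} → .(a < b) → a < b
    recompute-< {a} {b} a<b = decidable-stable (a <? b) (λ a≮b → contradiction-irr a<b a≮b)

all-elements? : {Q : Pred (Element m n) 0ℓ} → Decidable Q → Dec (∀ p → Q p)
all-elements? Q? =
  map′ (λ ¬∃ p → decidable-stable (Q? p) (λ ¬q → ¬∃ (p , ¬q)))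
       (λ ∀q (p , ¬q) → ¬q (∀q p))
       (¬? (any-element? (¬? ∘ Q?)))

private
  Within : ℕ → Element m n → Element m n → Set
  Within zero    p q = p ≡ q
  Within (suc f) p q = p ≡ q ⊎ ∃ λ r → p covers r × Within f r q

  within? : ∀ f (p q : Element m n) → Dec (Within f p q)
  within? zero    p q = p ≟ᴾ q
  within? (suc f) p q = p ≟ᴾ q ⊎-dec any-element? λ r → p covers? r ×-dec within? f r q

  within⇒≤ : ∀ f {p q : Element m n} → Within f p q → q ≤ᴾ p
  within⇒≤ zero    refl = ε
  within⇒≤ (suc f) (inj₁ refl) = ε
  within⇒≤ (suc f) (inj₂ (r , p⋗r , w)) = p⋗r ◅ within⇒≤ f w

  corank : Element m n → ℕ
  corank {m} {n} p = (m ∸ Element.i p) + (n ∸ Element.j p) + (Element.k p + Element.k p)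

  suc-∸-suc : ∀ {m i} → .(i < m) → suc (m ∸ suc i) ≡ m ∸ i
  suc-∸-suc {suc m} {zero}  _ = refl
  suc-∸-suc {suc m} {suc i} h = suc-∸-suc {m} {i} (s≤s⁻¹ h)

  ∸-step : ∀ m i → m ∸ i ≤ suc (m ∸ suc i)
  ∸-step zero    i = ≤-trans (≤-reflexive (0∸n≡0 i)) z≤n
  ∸-step (suc m) zero    = ≤-refl
  ∸-step (suc m) (suc i) = ∸-step m i

  corank-< : {p q : Element m n} → p covers q → suc (corank q) ≤ corank p
  corank-< {m} {n} {element i j k _ _ _ _ i<m} {element _ _ _ _ _ _ _ i′<m} (down-i refl refl refl) =
    ≤-reflexive (cong (λ x → x + (n ∸ j) + (k + k)) (suc-∸-suc i<m))
  corank-< {m} {n} {element i j k _ _ j<n _ _} (down-j refl refl refl) =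
    ≤-reflexive (cong (_+ (k + k)) (trans (sym (+-suc (m ∸ i) _)) (cong ((m ∸ i) +_) (suc-∸-suc j<n))))
  corank-< {m} {n} {element _ j _ _ _ _ _ i<m} {element i _ k _ _ _ _ _} (down-ik refl refl refl) =
    ≤-trans (s≤s (+-monoˡ-≤ (k + k) (+-monoˡ-≤ (n ∸ j) (∸-step m i))))
      (≤-reflexive (solve 3 (λ a b k → con 1 :+ ((con 1 :+ a) :+ b :+ (k :+ k))
                                     := a :+ b :+ ((con 1 :+ k) :+ (con 1 :+ k)))
                            refl (m ∸ suc i) (n ∸ j) k))
    where open +-*-Solver
  corank-< {m} {n} {element i _ _ _ _ _ _ _} {element _ j k _ _ _ _ _} (down-jk refl refl refl) =
    ≤-trans (s≤s (+-monoˡ-≤ (k + k) (+-monoʳ-≤ (m ∸ i) (∸-step n j))))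
      (≤-reflexive (solve 3 (λ a b k → con 1 :+ (a :+ (con 1 :+ b) :+ (k :+ k))
                                     := a :+ b :+ ((con 1 :+ k) :+ (con 1 :+ k)))
                            refl (m ∸ i) (n ∸ suc j) k))
    where open +-*-Solver

  ≤⇒within : ∀ f {p q : Element m n} → corank p ≤ f → q ≤ᴾ p → Within f p q
  ≤⇒within zero    _ ε = refl
  ≤⇒within (suc f) _ ε = inj₁ refl
  ≤⇒within zero    h (c ◅ _) = contradiction (≤-trans (corank-< c) h) λ ()
  ≤⇒within (suc f) h (c ◅ s) = inj₂ (_ , c , ≤⇒within f (s≤s⁻¹ (≤-trans (corank-< c) h)) s)

_≤ᴾ?_ : (q p : Element m n) → Dec (q ≤ᴾ p)
q ≤ᴾ? p = map′ (within⇒≤ (corank p)) (≤⇒within (corank p) ≤-refl) (within? (corank p) p q)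

-- There are finitely many elements, so classically Boolean-valued subsets are all subsets.
record OrderIdeal (m n : ℕ) : Set where
  field
    member : Element m n → Bool
    closed : ∀ {p q} → q ≤ᴾ p → T (member p) → T (member q)

open OrderIdeal public

J-setoid : ℕ → ℕ → Setoid 0ℓ 0ℓ
J-setoid m n = On.setoid (Element m n →-setoid Bool) member

Minimal : Pred (Element m n) 0ℓ → Pred (Element m n) 0ℓ
Minimal S p = S p × (∀ q → S q → q ≤ᴾ p → q ≡ p)

Generated : Pred (Element m n) 0ℓ → Pred (Element m n) 0ℓ
Generated S p = ∃ λ q → S q × p ≤ᴾ q

Complement : OrderIdeal m n → Pred (Element m n) 0ℓ
Complement X p = ¬ T (member X p)

generated? : (X : OrderIdeal m n) → Decidable (Generated (Minimal (Complement X)))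
generated? X p = any-element? λ q → minimal? q ×-dec p ≤ᴾ? q
  where
  minimal? : Decidable (Minimal (Complement X))
  minimal? q = ¬? (T? (member X q)) ×-dec
    all-elements? λ r → ¬? (T? (member X r)) →-dec r ≤ᴾ? q →-dec r ≟ᴾ q

rowmotion : OrderIdeal m n → OrderIdeal m n
rowmotion X .member p = isYes (generated? X p)
rowmotion X .closed {p} {q} q≤p h =
  let (r , min , p≤r) = toWitness {a? = generated? X p} h in
  fromWitness {a? = generated? X q} (r , min , p≤r ◅◅ q≤p)

-- vert i j joins v_{i,j} to v_{i+1,j}; horiz i j joins v_{i,j} to v_{i,j+1}.
data Edge (m n : ℕ) : Set where
  vert  : ∀ i j → .(i ≤ m) → .(1 ≤ j) → .(j ≤ n) → Edge m n
  horiz : ∀ i j → .(1 ≤ i) → .(i ≤ m) → .(j ≤ n) → Edge m n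

endpoints : Edge m n → (ℕ × ℕ) × (ℕ × ℕ)
endpoints (vert  i j _ _ _) = (i , j) , (suc i , j)
endpoints (horiz i j _ _ _) = (i , j) , (i , suc j)

record InteriorVertex (m n : ℕ) : Set where
  constructor interior-vertex
  field
    row col : ℕ
    .1≤row : 1 ≤ row
    .row≤m : row ≤ m
    .1≤col : 1 ≤ col
    .col≤n : col ≤ n

Incident : Edge m n → InteriorVertex m n → Set
Incident e v = proj₁ (endpoints e) ≡ (row , col) ⊎ proj₂ (endpoints e) ≡ (row , col)
  where open InteriorVertex v

incidentEdges : InteriorVertex m n → List (Edge m n)
incidentEdges (interior-vertex i j 1≤i i≤m 1≤j j≤n) =
    vert (pred i) j (≤-trans pred[n]≤n i≤m) 1≤j j≤n
  ∷ vert i j i≤m 1≤j j≤n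
  ∷ horiz i (pred j) 1≤i i≤m (≤-trans pred[n]≤n j≤n)
  ∷ horiz i j 1≤i i≤m j≤n
  ∷ []

∈-incidentEdges : ∀ (e : Edge m n) v → e ∈ incidentEdges v ⇔ Incident e v
∈-incidentEdges {m} {n} e v = mk⇔ (to v) (from e v)
  where
  to : ∀ {e} v → e ∈ incidentEdges v → Incident {m} {n} e v
  to (interior-vertex zero j 1≤i _ _ _) _ = contradiction-irr 1≤i λ ()
  to (interior-vertex (suc i) zero _ _ 1≤j _) _ = contradiction-irr 1≤j λ ()
  to (interior-vertex (suc i) (suc j) _ _ _ _) (here refl) = inj₂ refl
  to (interior-vertex (suc i) (suc j) _ _ _ _) (there (here refl)) = inj₁ refl
  to (interior-vertex (suc i) (suc j) _ _ _ _) (there (there (here refl))) = inj₂ refl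
  to (interior-vertex (suc i) (suc j) _ _ _ _) (there (there (there (here refl)))) = inj₁ refl

  from : ∀ e v → Incident {m} {n} e v → e ∈ incidentEdges v
  from (vert  _ _ _ _ _) (interior-vertex _ _ _ _ _ _) (inj₁ refl) = there (here refl)
  from (vert  _ _ _ _ _) (interior-vertex _ _ _ _ _ _) (inj₂ refl) = here refl
  from (horiz _ _ _ _ _) (interior-vertex _ _ _ _ _ _) (inj₁ refl) = there (there (there (here refl)))
  from (horiz _ _ _ _ _) (interior-vertex _ _ _ _ _ _) (inj₂ refl) = there (there (here refl))

incidentEdges-unique : (v : InteriorVertex m n) → Unique (incidentEdges v)
incidentEdges-unique (interior-vertex zero j 1≤i _ _ _) = contradiction-irr 1≤i λ ()
incidentEdges-unique (interior-vertex (suc i) zero _ _ 1≤j _) = contradiction-irr 1≤j λ ()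
incidentEdges-unique (interior-vertex (suc i) (suc j) _ _ _ _) =
    ((λ ()) ∷ (λ ()) ∷ (λ ()) ∷ [])
  ∷ ((λ ()) ∷ (λ ()) ∷ [])
  ∷ ((λ ()) ∷ [])
  ∷ [] ∷ []

-- All subgraphs considered contain every vertex.
Subgraph : ℕ → ℕ → Set
Subgraph m n = Edge m n → Bool

degree : Subgraph m n → InteriorVertex m n → ℕ
degree F v = length (filterᵇ F (incidentEdges v))

record IsPFPL {m n : ℕ} (F : Subgraph m n) : Set where
  field
    two  : ∀ v → degree F v ≡ 2
    top  : ∀ j (1≤j : 1 ≤ j) (j≤n : j ≤ n) →
           T (F (vert 0 j z≤n 1≤j j≤n)) ⇔ parity j ≡ 1ℙ
    left : ∀ i (1≤i : 1 ≤ i) (i≤m : i ≤ m) →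
           T (F (horiz i 0 1≤i i≤m z≤n)) ⇔ parity i ≡ 0ℙ

record PFPL (m n : ℕ) : Set where
  constructor pfpl
  field
    subgraph : Subgraph m n
    isPFPL   : IsPFPL subgraph

open PFPL public

PFPL-setoid : ℕ → ℕ → Setoid 0ℓ 0ℓ
PFPL-setoid m n = On.setoid (Edge m n →-setoid Bool) subgraph

record Square (m n : ℕ) : Set where
  constructor square
  field
    row col : ℕ
    .row≤m : row ≤ m
    .col≤n : col ≤ n

-- Is the edge present?  Non-edges of the graph count as absent.
hasVert hasHoriz : Subgraph m n → ℕ → ℕ → Bool
hasVert {m} {n} F i j with i ≤? m ×-dec 1 ≤? j ×-dec j ≤? n
... | yes (i≤m , 1≤j , j≤n) = F (vert i j i≤m 1≤j j≤n)
... | no _ = false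
hasHoriz {m} {n} F i j with 1 ≤? i ×-dec i ≤? m ×-dec j ≤? n
... | yes (1≤i , i≤m , j≤n) = F (horiz i j 1≤i i≤m j≤n)
... | no _ = false

hasVert-edge : ∀ (F : Subgraph m n) i j .(p : i ≤ m) .(q : 1 ≤ j) .(r : j ≤ n) →
               hasVert F i j ≡ F (vert i j p q r)
hasVert-edge {m} {n} F i j p q r with i ≤? m ×-dec 1 ≤? j ×-dec j ≤? n
... | yes _ = refl
... | no ¬h = contradiction-irr (p , q , r) ¬h

hasHoriz-edge : ∀ (F : Subgraph m n) i j .(p : 1 ≤ i) .(q : i ≤ m) .(r : j ≤ n) →
                hasHoriz F i j ≡ F (horiz i j p q r)
hasHoriz-edge {m} {n} F i j p q r with 1 ≤? i ×-dec i ≤? m ×-dec j ≤? n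
... | yes _ = refl
... | no ¬h = contradiction-irr (p , q , r) ¬h


record Sides : Set where
  constructor ⟨T_,B_,L_,R_⟩
  field
    top bottom left right : Bool

sides : Subgraph m n → Square m n → Sides
sides F (square i j _ _) =
  ⟨T hasHoriz F i j ,B hasHoriz F (suc i) j ,L hasVert F i j ,R hasVert F i (suc j) ⟩

setSides : Square m n → Sides → Subgraph m n → Subgraph m n
setSides (square i j _ _) s F e@(vert a b _ _ _) =
  if (a ≡ᵇ i) ∧ (b ≡ᵇ j) then Sides.left s else
  if (a ≡ᵇ i) ∧ (b ≡ᵇ suc j) then Sides.right s else F e
setSides (square i j _ _) s F e@(horiz a b _ _ _) =
  if (a ≡ᵇ i) ∧ (b ≡ᵇ j) then Sides.top s else
  if (a ≡ᵇ suc i) ∧ (b ≡ᵇ j) then Sides.bottom s else F e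

-- rightExterior, bottomExterior and corner lack the right side, the bottom
-- side, and both, respectively.
data Kind : Set where
  boundary interior rightExterior bottomExterior corner : Kind

kind : Square m n → Kind
kind {m} {n} (square i j _ _) =
  if (i ≡ᵇ 0) ∨ (j ≡ᵇ 0) then boundary else
  if i <ᵇ m then (if j <ᵇ n then interior else rightExterior)
            else (if j <ᵇ n then bottomExterior else corner)

swap : Kind → Sides → Sides
swap interior       ⟨T true  ,B true  ,L false ,R false ⟩ = ⟨T false ,B false ,L true  ,R true  ⟩
swap interior       ⟨T false ,B false ,L true  ,R true  ⟩ = ⟨T true  ,B true  ,L false ,R false ⟩
swap rightExterior  ⟨T false ,B false ,L true  ,R false ⟩ = ⟨T true  ,B true  ,L false ,R false ⟩
swap rightExterior  ⟨T true  ,B true  ,L false ,R false ⟩ = ⟨T false ,B false ,L true  ,R false ⟩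
swap bottomExterior ⟨T true  ,B false ,L false ,R false ⟩ = ⟨T false ,B false ,L true  ,R true  ⟩
swap bottomExterior ⟨T false ,B false ,L true  ,R true  ⟩ = ⟨T true  ,B false ,L false ,R false ⟩
swap corner         ⟨T false ,B false ,L true  ,R false ⟩ = ⟨T true  ,B false ,L false ,R false ⟩
swap corner         ⟨T true  ,B false ,L false ,R false ⟩ = ⟨T false ,B false ,L true  ,R false ⟩
swap _              s                                     = s

localSubgraph : Square m n → Subgraph m n → Subgraph m n
localSubgraph Q F = setSides Q (swap (kind Q) (sides F Q)) F

private
  χ : Bool → ℕ
  χ true  = 1
  χ false = 0

  all-bools? : {P : Bool → Set} → (∀ b → Dec (P b)) → Dec (∀ b → P b)
  all-bools? P? = map′ (λ { (f , t) false → f ; (f , t) true → t }) (λ h → h false , h true)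
                       (P? false ×-dec P? true)

  all-sides? : {P : Sides → Set} → (∀ s → Dec (P s)) → Dec (∀ s → P s)
  all-sides? P? =
    map′ (λ h s → h (Sides.top s) (Sides.bottom s) (Sides.left s) (Sides.right s))
         (λ h t b l r → h ⟨T t ,B b ,L l ,R r ⟩)
         (all-bools? λ t → all-bools? λ b → all-bools? λ l → all-bools? λ r →
          P? ⟨T t ,B b ,L l ,R r ⟩)

  Balanced : (Sides → Bool) → (Sides → Bool) → Kind → Set
  Balanced f g κ = ∀ s → χ (f (swap κ s)) + χ (g (swap κ s)) ≡ χ (f s) + χ (g s)

  balanced? : ∀ f g κ → Dec (Balanced f g κ)
  balanced? f g κ = all-sides? λ s → _ ≟ _

  open Sides

  balanced-LT : ∀ κ → Balanced left top κ
  balanced-LT boundary       = toWitness {a? = balanced? left top boundary} _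
  balanced-LT interior       = toWitness {a? = balanced? left top interior} _
  balanced-LT rightExterior  = toWitness {a? = balanced? left top rightExterior} _
  balanced-LT bottomExterior = toWitness {a? = balanced? left top bottomExterior} _
  balanced-LT corner         = toWitness {a? = balanced? left top corner} _

  balanced-RT : ∀ i j .(p : i ≤ m) .(q : j ≤ n) → j < n → Balanced right top (kind {m} {n} (square i j p q))
  balanced-RT {m} {n} i j _ _ j<n with (i ≡ᵇ 0) ∨ (j ≡ᵇ 0) | i <ᵇ m | j <ᵇ n | <⇒<ᵇ j<n
  ... | true  | _     | true | _ = toWitness {a? = balanced? right top boundary} _
  ... | false | true  | true | _ = toWitness {a? = balanced? right top interior} _
  ... | false | false | true | _ = toWitness {a? = balanced? right top bottomExterior} _

  balanced-LB : ∀ i j .(p : i ≤ m) .(q : j ≤ n) → i < m → Balanced left bottom (kind {m} {n} (square i j p q))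
  balanced-LB {m} {n} i j _ _ i<m with (i ≡ᵇ 0) ∨ (j ≡ᵇ 0) | i <ᵇ m | j <ᵇ n | <⇒<ᵇ i<m
  ... | true  | true | _     | _ = toWitness {a? = balanced? left bottom boundary} _
  ... | false | true | true  | _ = toWitness {a? = balanced? left bottom interior} _
  ... | false | true | false | _ = toWitness {a? = balanced? left bottom rightExterior} _

  balanced-RB : ∀ i j .(p : i ≤ m) .(q : j ≤ n) → i < m → j < n →
                Balanced right bottom (kind {m} {n} (square i j p q))
  balanced-RB {m} {n} i j _ _ i<m j<n
    with (i ≡ᵇ 0) ∨ (j ≡ᵇ 0) | i <ᵇ m | j <ᵇ n | <⇒<ᵇ i<m | <⇒<ᵇ j<n
  ... | true  | true | true | _ | _ = toWitness {a? = balanced? right bottom boundary} _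
  ... | false | true | true | _ | _ = toWitness {a? = balanced? right bottom interior} _

  degree-χ : ∀ (F : Subgraph m n) a b .p .q .r .s →
    degree F (interior-vertex (suc a) (suc b) p q r s) ≡
      (χ (F (vert a (suc b) (≤-trans (n≤1+n a) q) (s≤s z≤n) s)) +
       χ (F (vert (suc a) (suc b) q (s≤s z≤n) s))) +
      (χ (F (horiz (suc a) b (s≤s z≤n) q (≤-trans (n≤1+n b) s))) +
       χ (F (horiz (suc a) (suc b) (s≤s z≤n) q s)))
  degree-χ F a b p q r s = four (vert _ _ _ _ _) (vert _ _ _ _ _) (horiz _ _ _ _ _) (horiz _ _ _ _ _)
    where
    count : ∀ e es → length (filterᵇ F (e ∷ es)) ≡ χ (F e) + length (filterᵇ F es)
    count e es with F e
    ... | true  = refl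
    ... | false = refl

    four : ∀ e₁ e₂ e₃ e₄ → length (filterᵇ F (e₁ ∷ e₂ ∷ e₃ ∷ e₄ ∷ [])) ≡
           (χ (F e₁) + χ (F e₂)) + (χ (F e₃) + χ (F e₄))
    four e₁ e₂ e₃ e₄ =
      trans (count e₁ _) (trans (cong (χ (F e₁) +_) (trans (count e₂ _) (cong (χ (F e₂) +_)
        (trans (count e₃ _) (cong (χ (F e₃) +_) (trans (count e₄ _) (+-identityʳ _)))))))
        (sym (+-assoc (χ (F e₁)) (χ (F e₂)) _)))

  ≡ᵇ-true : ∀ a b → (a ≡ᵇ b) ≡ true → a ≡ b
  ≡ᵇ-true a b eq = ≡ᵇ⇒≡ a b (subst T (sym eq) _)

  recompute-≤ : ∀ {a b} → .(a ≤ b) → a ≤ b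
  recompute-≤ {a} {b} a≤b = decidable-stable (a ≤? b) (λ a≰b → contradiction-irr a≤b a≰b)

  degree-local : ∀ (Q : Square m n) F v → degree (localSubgraph Q F) v ≡ degree F v
  degree-local Q F (interior-vertex zero _ 1≤i _ _ _) = contradiction-irr 1≤i λ ()
  degree-local Q F (interior-vertex (suc a) zero _ _ 1≤j _) = contradiction-irr 1≤j λ ()
  degree-local {m} {n} Q@(square i j i≤m j≤n) F (interior-vertex (suc a) (suc b) p q r s) =
    trans (degree-χ (localSubgraph Q F) a b p q r s) (trans four (sym (degree-χ F a b p q r s)))
    where
    up    = F (vert a (suc b) (≤-trans (n≤1+n a) q) (s≤s z≤n) s)
    down  = F (vert (suc a) (suc b) q (s≤s z≤n) s)
    left₀ = F (horiz (suc a) b (s≤s z≤n) q (≤-trans (n≤1+n b) s))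
    right₀ = F (horiz (suc a) (suc b) (s≤s z≤n) q s)
    new old : Sides
    new = swap (kind Q) (sides F Q)
    old = sides F Q

    vert₁ : Bool → Bool → Bool → Bool → Bool
    vert₁ A B B′ e = if A ∧ B then left new else if A ∧ B′ then right new else e
    horiz₁ : Bool → Bool → Bool → Bool → Bool
    horiz₁ A A′ B e = if A ∧ B then top new else if A′ ∧ B then bottom new else e

    pair : ∀ w x y z w′ x′ y′ z′ → w + y ≡ w′ + y′ → x + z ≡ x′ + z′ →
           (w + x) + (y + z) ≡ (w′ + x′) + (y′ + z′)
    pair w x y z w′ x′ y′ z′ h k =
      trans (interchange w x y z) (trans (cong₂ _+_ h k) (interchange w′ y′ x′ z′))

    cross : ∀ w x y z w′ x′ y′ z′ → w + z ≡ w′ + z′ → x + y ≡ x′ + y′ →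
            (w + x) + (y + z) ≡ (w′ + x′) + (y′ + z′)
    cross w x y z w′ x′ y′ z′ h k =
      trans (cong ((w + x) +_) (+-comm y z))
        (trans (pair w x z y w′ x′ z′ y′ h k) (cong ((w′ + x′) +_) (+-comm z′ y′)))

    four : (χ (vert₁ (a ≡ᵇ i) (suc b ≡ᵇ j) (b ≡ᵇ j) up) +
            χ (vert₁ (suc a ≡ᵇ i) (suc b ≡ᵇ j) (b ≡ᵇ j) down)) +
           (χ (horiz₁ (suc a ≡ᵇ i) (a ≡ᵇ i) (b ≡ᵇ j) left₀) +
            χ (horiz₁ (suc a ≡ᵇ i) (a ≡ᵇ i) (suc b ≡ᵇ j) right₀)) ≡
           (χ up + χ down) + (χ left₀ + χ right₀)
    four with a ≡ᵇ i in A | suc a ≡ᵇ i in A′ | b ≡ᵇ j in B | suc b ≡ᵇ j in B′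
    ... | true  | true  | _ | _ = contradiction (trans (≡ᵇ-true (suc a) i A′) (sym (≡ᵇ-true a i A))) 1+n≢n
    ... | false | _ | true  | true = contradiction (trans (≡ᵇ-true (suc b) j B′) (sym (≡ᵇ-true b j B))) 1+n≢n
    ... | true  | _ | true  | true = contradiction (trans (≡ᵇ-true (suc b) j B′) (sym (≡ᵇ-true b j B))) 1+n≢n
    ... | false | false | false | false = refl
    ... | false | false | false | true  = refl
    ... | false | false | true  | false = refl
    ... | true  | false | false | false = refl
    ... | false | true  | false | false = refl
    ... | false | true  | false | true  with refl ← ≡ᵇ-true (suc a) i A′ | refl ← ≡ᵇ-true (suc b) j B′ =
      pair (χ up) (χ (left new)) (χ left₀) (χ (top new)) (χ up) (χ down) (χ left₀) (χ right₀) refl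
        (trans (balanced-LT (kind Q) old)
          (cong₂ (λ x y → χ x + χ y) (hasVert-edge F (suc a) (suc b) _ _ _) (hasHoriz-edge F (suc a) (suc b) _ _ _)))
    ... | false | true  | true  | false with refl ← ≡ᵇ-true (suc a) i A′ | refl ← ≡ᵇ-true b j B =
      cross (χ up) (χ (right new)) (χ (top new)) (χ right₀) (χ up) (χ down) (χ left₀) (χ right₀) refl
        (trans (balanced-RT (suc a) b i≤m j≤n (recompute-≤ s) old)
          (cong₂ (λ x y → χ x + χ y) (hasVert-edge F (suc a) (suc b) _ _ _) (hasHoriz-edge F (suc a) b _ _ _)))
    ... | true  | false | false | true  with refl ← ≡ᵇ-true a i A | refl ← ≡ᵇ-true (suc b) j B′ =
      cross (χ (left new)) (χ down) (χ left₀) (χ (bottom new)) (χ up) (χ down) (χ left₀) (χ right₀)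
        (trans (balanced-LB a (suc b) i≤m j≤n (recompute-≤ q) old)
          (cong₂ (λ x y → χ x + χ y) (hasVert-edge F a (suc b) _ _ _) (hasHoriz-edge F (suc a) (suc b) _ _ _))) refl
    ... | true  | false | true  | false with refl ← ≡ᵇ-true a i A | refl ← ≡ᵇ-true b j B =
      pair (χ (right new)) (χ down) (χ (bottom new)) (χ right₀) (χ up) (χ down) (χ left₀) (χ right₀)
        (trans (balanced-RB a b i≤m j≤n (recompute-≤ q) (recompute-≤ s) old)
          (cong₂ (λ x y → χ x + χ y) (hasVert-edge F a (suc b) _ _ _) (hasHoriz-edge F (suc a) b _ _ _))) refl

  local-top : ∀ (Q : Square m n) F j .(p : 1 ≤ j) .(q : j ≤ n) →
              localSubgraph Q F (vert 0 j z≤n p q) ≡ F (vert 0 j z≤n p q)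
  local-top (square (suc i) c _ _) F j p q = refl
  local-top (square zero c _ _) F j p q with j ≡ᵇ c in B | j ≡ᵇ suc c in B′
  ... | true  | _ with refl ← ≡ᵇ-true j c B = hasVert-edge F 0 j _ _ _
  ... | false | true with refl ← ≡ᵇ-true j (suc c) B′ = hasVert-edge F 0 j _ _ _
  ... | false | false = refl

  local-left : ∀ (Q : Square m n) F i .(p : 1 ≤ i) .(q : i ≤ m) →
               localSubgraph Q F (horiz i 0 p q z≤n) ≡ F (horiz i 0 p q z≤n)
  local-left (square zero zero _ _) F i p q with i ≡ᵇ zero in A | i ≡ᵇ suc zero in A′
  ... | true  | _ with refl ← ≡ᵇ-true i zero A = hasHoriz-edge F i 0 _ _ _
  ... | false | true with refl ← ≡ᵇ-true i (suc zero) A′ = hasHoriz-edge F i 0 _ _ _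
  ... | false | false = refl
  local-left (square r@(suc _) zero _ _) F i p q with i ≡ᵇ r in A | i ≡ᵇ suc r in A′
  ... | true  | _ with refl ← ≡ᵇ-true i r A = hasHoriz-edge F i 0 _ _ _
  ... | false | true with refl ← ≡ᵇ-true i (suc r) A′ = hasHoriz-edge F i 0 _ _ _
  ... | false | false = refl
  local-left (square r (suc c) _ _) F i p q with i ≡ᵇ r | i ≡ᵇ suc r
  ... | true  | true  = refl
  ... | true  | false = refl
  ... | false | true  = refl
  ... | false | false = refl

  local-isPFPL : ∀ (Q : Square m n) F → IsPFPL F → IsPFPL (localSubgraph Q F)
  local-isPFPL Q F h = record
    { two  = λ v → trans (degree-local Q F v) (IsPFPL.two h v)
    ; top  = λ j p q → subst (λ b → T b ⇔ parity j ≡ 1ℙ) (sym (local-top Q F j p q)) (IsPFPL.top h j p q)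
    ; left = λ i p q → subst (λ b → T b ⇔ parity i ≡ 0ℙ) (sym (local-left Q F i p q)) (IsPFPL.left h i p q)
    }

localAction : Square m n → PFPL m n → PFPL m n
localAction Q F = pfpl (localSubgraph Q (subgraph F)) (local-isPFPL Q (subgraph F) (isPFPL F))

allSquares : ∀ m n → List (Square m n)
allSquares m n = cartesianProductWith
  (λ i j → square (toℕ i) (toℕ j) (s≤s⁻¹ (Fin.toℕ<n i)) (s≤s⁻¹ (Fin.toℕ<n j)))
  (allFin (suc m)) (allFin (suc n))

squaresOfParity : Parity → List (Square m n)
squaresOfParity π = filter (λ Q → parity (Square.row Q + Square.col Q) Parity.≟ π) (allSquares _ _)

-- Distinct squares of the same parity share no side, so the order in which
-- they are processed is immaterial.
applyAll : Parity → PFPL m n → PFPL m n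
applyAll π F = foldr localAction F (squaresOfParity π)

gyration : PFPL m n → PFPL m n
gyration F = applyAll 1ℙ (applyAll 0ℙ F)

{-# OPTIONS --safe #-}
module Submission where

-- A configuration is encoded by heights on the squares, zero in the first row and column and
-- increasing by 0 or 1 to the right and downwards; degree two at a vertex says that the four steps
-- around it close up.  Putting (i, j, k) into an ideal when k is less than the height of the square
-- Q_{i+1,j+1} turns heights into order ideals and the local action on that square into the toggle of
-- all elements (i, j, k).  Gyration thus toggles the elements with i + j even and then those with
-- i + j odd.
--
-- Let x_t be the state after t steps of this alternating toggling.  Rowmotion toggles the poset from
-- top to bottom, which is what two steps do along the slanted slice { p | p ∈ x_{time p} }, where
-- time (i, j, k) = i + j - 2k grows by one along each cover.  The slanted slice is obtained from x_0
-- by toggles, each of which is an involution, so passing to it is a bijection.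

open import Defs
open import Data.Nat.Base using (ℕ; NonZero)
open import Data.Product.Base using (Σ-syntax)
open import Function.Bundles using (Bijection)
open import Relation.Binary.Bundles using (Setoid)
open import Data.Bool.Base using (Bool; true; false; T; not; _∧_; _xor_; if_then_else_)
import Data.Bool.Properties as Bool
open import Data.Bool.Properties using (T?; not-involutive; xor-annihilates-not; not-distribʳ-xor; not-distribˡ-xor)
open import Data.Empty using (⊥-elim)
open import Data.Fin.Base using (Fin; toℕ; fromℕ<)
import Data.Fin.Properties as Fin
open import Data.List.Base using (List; []; _∷_; length; filterᵇ; foldr)
open import Data.List.Membership.Propositional using (lose)
open import Data.List.Membership.Propositional.Properties using (∈-filter⁺; ∈-filter⁻; ∈-cartesianProductWith⁺; ∈-allFin)
open import Data.List.Relation.Unary.All as All using (All; []; _∷_)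
open import Data.List.Relation.Unary.AllPairs using ([]; _∷_)
open import Data.List.Relation.Unary.Any using (Any; here; there)
open import Data.List.Relation.Unary.Unique.Propositional using (Unique)
open import Data.List.Relation.Unary.Unique.Propositional.Properties using (cartesianProductWith⁺; filter⁺; allFin⁺)
open import Data.Nat.Base hiding (ℕ; NonZero)
open import Data.Nat.Properties
open import Data.Parity.Base using (Parity; 0ℙ; 1ℙ)
import Data.Parity.Properties as Parity
open import Data.Product.Base using (∃; _×_; _,_; proj₁; proj₂)
open import Data.Sum.Base using (inj₁; inj₂)
open import Function.Base using (_∘_; id)
open import Function.Bundles using (Equivalence; _⇔_; mk⇔)
import Function.Construct.Composition as Composition
import Function.Construct.Identity as Identity
open import Level using (0ℓ)
open import Relation.Binary.Construct.Closure.ReflexiveTransitive using (ε; _◅_; _◅◅_)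
open import Relation.Binary.PropositionalEquality using (_≡_; _≢_; refl; sym; trans; cong; cong₂; subst; module ≡-Reasoning)
open import Relation.Nullary using (Dec; yes; no; ¬_; contradiction)
open import Relation.Nullary.Decidable using (map′; _×-dec_; ¬?; _→-dec_; decidable-stable; recompute; toWitness; fromWitness)
open import Relation.Nullary.Negation using (contradiction-irr)
open import Relation.Unary using (Pred; Decidable)

private
  variable
    m n : ℕ

-- The obstacle is the order of toggling: gyration treats a whole parity class at once, rowmotion
-- goes from top to bottom, so the two can only agree after conjugation. The slanted slice
-- reconciles them because `p` is toggled at step `time p`, and all neighbours of `p` have the
-- opposite parity and rest during that step. Hence below `p` the step sees the values of the old
-- slice, and above `p` it already sees the values of the slice two steps later. A top-to-bottom
-- toggle sees exactly this. A slice read off directly might fail to be an ideal or might forget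
-- information; building it from toggles of ideals that are their own inverses excludes both. The
-- parity twist in the heights complements exactly two of the four edges at a vertex, which turns
-- "the sum is two" into an equality of two sums of two rises. With the same twist, the alternating
-- boundary edges become heights that vanish along the first row and column.

T-injective : ∀ {a b} → (T a → T b) → (T b → T a) → a ≡ b
T-injective {true}  {true}  f g = refl
T-injective {true}  {false} f g = ⊥-elim (f _)
T-injective {false} {true}  f g = ⊥-elim (g _)
T-injective {false} {false} f g = refl

T-not⁺ : ∀ {b} → ¬ T b → T (not b)
T-not⁺ {true}  h = h _
T-not⁺ {false} h = _

T-not⁻ : ∀ {b} → T (not b) → ¬ T b
T-not⁻ {false} _ ()

negateIf : {A : Set} → Dec A → Bool → Bool
negateIf (yes _) b = not b
negateIf (no  _) b = b

negateIf-yes : ∀ {A : Set} (A? : Dec A) b → A → negateIf A? b ≡ not b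
negateIf-yes (yes _)  b a = refl
negateIf-yes (no ¬a)  b a = contradiction a ¬a

negateIf-no : ∀ {A : Set} (A? : Dec A) b → ¬ A → negateIf A? b ≡ b
negateIf-no (yes a) b ¬a = contradiction a ¬a
negateIf-no (no _)  b ¬a = refl

-- Toggling order ideals

infix 4 _≈_
_≈_ : OrderIdeal m n → OrderIdeal m n → Set
X ≈ Y = ∀ p → member X p ≡ member Y p

-- Covers adding and removing at once: lower covers inside let `p` enter, upper covers outside let
-- `p` leave. Only the neighbours of `p` are consulted, so toggling `p` itself preserves the
-- condition.
Toggleable : OrderIdeal m n → Pred (Element m n) 0ℓ
Toggleable X p = (∀ q → p covers q → T (member X q)) × (∀ q → q covers p → ¬ T (member X q))

abstract
  toggleable? : (X : OrderIdeal m n) → Decidable (Toggleable X)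
  toggleable? X p =
    all-elements? (λ q → p covers? q →-dec T? (member X q)) ×-dec
    all-elements? (λ q → q covers? p →-dec ¬? (T? (member X q)))

Toggleable-resp : (X Y : OrderIdeal m n) (p : Element m n) →
  (∀ q → p covers q → member X q ≡ member Y q) →
  (∀ q → q covers p → member X q ≡ member Y q) →
  Toggleable X p → Toggleable Y p
Toggleable-resp X Y p below above (lower , upper) =
  (λ q p⋗q → subst T (below q p⋗q) (lower q p⋗q)) ,
  (λ q q⋗p → upper q q⋗p ∘ subst T (sym (above q q⋗p)))

-- Elements of such a set do not see each other's toggles, so all of them can be toggled
-- simultaneously.
record IndependentSet (m n : ℕ) : Set₁ where
  field
    Member      : Pred (Element m n) 0ℓ
    member?     : Decidable Member
    independent : ∀ {p q} → p covers q → Member p → ¬ Member q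

open IndependentSet

down-closed : (b : Element m n → Bool) → (∀ {p q} → p covers q → T (b p) → T (b q)) →
  ∀ {p q} → q ≤ᴾ p → T (b p) → T (b q)
down-closed b step ε           h = h
down-closed b step (p⋗r ◅ r≥q) h = down-closed b step r≥q (step p⋗r h)

closed-cover : (X : OrderIdeal m n) {p q : Element m n} → p covers q → T (member X p) → T (member X q)
closed-cover X p⋗q = closed X (p⋗q ◅ ε)

toggleMember : IndependentSet m n → OrderIdeal m n → Element m n → Bool
toggleMember S X p = negateIf (member? S p ×-dec toggleable? X p) (member X p)

toggleMember-yes : (S : IndependentSet m n) (X : OrderIdeal m n) (p : Element m n) →
  Member S p → Toggleable X p → toggleMember S X p ≡ not (member X p)
toggleMember-yes S X p s t = negateIf-yes (member? S p ×-dec toggleable? X p) _ (s , t)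

toggleMember-no : (S : IndependentSet m n) (X : OrderIdeal m n) (p : Element m n) →
  ¬ (Member S p × Toggleable X p) → toggleMember S X p ≡ member X p
toggleMember-no S X p h = negateIf-no (member? S p ×-dec toggleable? X p) _ h

toggleMember-closed : (S : IndependentSet m n) (X : OrderIdeal m n) {p q : Element m n} →
  p covers q → T (toggleMember S X p) → T (toggleMember S X q)
toggleMember-closed S X {p} {q} p⋗q h
  with member? S p ×-dec toggleable? X p | member? S q ×-dec toggleable? X q
... | yes (sp , _)           | yes (sq , _)         = contradiction sq (independent S p⋗q sp)
... | yes (_ , lower , _)    | no _                 = lower q p⋗q
... | no _                   | yes (_ , _ , upper)  = contradiction h (upper p p⋗q)
... | no _                   | no _                 = closed-cover X p⋗q h

toggle : IndependentSet m n → OrderIdeal m n → OrderIdeal m n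
toggle S X .member = toggleMember S X
toggle S X .closed = down-closed (toggleMember S X) (toggleMember-closed S X)

-- Two different sets and ideals are allowed, so that a step of `sheared` can be compared with a
-- step of `evolve` at a single element.
toggleMember-local : (S S′ : IndependentSet m n) (X Y : OrderIdeal m n) (p : Element m n) →
  (Member S p ⇔ Member S′ p) → member X p ≡ member Y p →
  (∀ q → p covers q → member X q ≡ member Y q) →
  (∀ q → q covers p → member X q ≡ member Y q) →
  toggleMember S X p ≡ toggleMember S′ Y p
toggleMember-local S S′ X Y p S⇔S′ at below above
  with member? S p ×-dec toggleable? X p | member? S′ p ×-dec toggleable? Y p
... | yes _       | yes _       = cong not at
... | no _        | no _        = at
... | yes (s , t) | no ¬h       =
  contradiction (Equivalence.to S⇔S′ s , Toggleable-resp X Y p below above t) ¬h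
... | no ¬h       | yes (s , t) =
  contradiction (Equivalence.from S⇔S′ s ,
    Toggleable-resp Y X p (λ q c → sym (below q c)) (λ q c → sym (above q c)) t) ¬h

toggle-cong : (S : IndependentSet m n) {X Y : OrderIdeal m n} → X ≈ Y → toggle S X ≈ toggle S Y
toggle-cong S {X} {Y} X≈Y p =
  toggleMember-local S S X Y p (mk⇔ id id) (X≈Y p) (λ q _ → X≈Y q) (λ q _ → X≈Y q)

-- The neighbours of an element of `S` lie outside `S` and stay fixed, so the element is toggleable
-- after the toggle exactly when it was before.
toggle-involutive : (S : IndependentSet m n) (X : OrderIdeal m n) → toggle S (toggle S X) ≈ X
toggle-involutive {m} {n} S X p = by-cases (member? S p) (toggleable? X p)
  where
  fixed : ∀ q → ¬ Member S q → member X q ≡ toggleMember S X q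
  fixed q ¬s = sym (toggleMember-no S X q (¬s ∘ proj₁))

  below : Member S p → ∀ q → p covers q → member X q ≡ toggleMember S X q
  below s q p⋗q = fixed q (independent S p⋗q s)

  above : Member S p → ∀ q → q covers p → member X q ≡ toggleMember S X q
  above s q q⋗p = fixed q (λ s′ → independent S q⋗p s′ s)

  by-cases : Dec (Member S p) → Dec (Toggleable X p) → toggleMember S (toggle S X) p ≡ member X p
  by-cases (no ¬s) _ =
    trans (toggleMember-no S (toggle S X) p (¬s ∘ proj₁)) (toggleMember-no S X p (¬s ∘ proj₁))
  by-cases (yes s) (yes t) =
    trans (toggleMember-yes S (toggle S X) p s (Toggleable-resp X (toggle S X) p (below s) (above s) t))
      (trans (cong not (toggleMember-yes S X p s t)) (not-involutive _))
  by-cases (yes s) (no ¬t) =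
    trans (toggleMember-no S (toggle S X) p (¬t ∘ back ∘ proj₂)) (toggleMember-no S X p (¬t ∘ proj₂))
    where
    back : Toggleable (toggle S X) p → Toggleable X p
    back = Toggleable-resp (toggle S X) X p (λ q c → sym (below s q c)) (λ q c → sym (above s q c))

involution⇒bijection : (f : OrderIdeal m n → OrderIdeal m n) →
  (∀ {X Y} → X ≈ Y → f X ≈ f Y) → (∀ X → f (f X) ≈ X) → Bijection (J-setoid m n) (J-setoid m n)
involution⇒bijection f f-cong f-inv = record
  { to        = f
  ; cong      = f-cong
  ; bijective =
      (λ {X} {Y} fX≈fY p → trans (sym (f-inv X p)) (trans (f-cong fX≈fY p) (f-inv Y p))) ,
      (λ Y → f Y , λ {Z} Z≈fY p → trans (f-cong Z≈fY p) (f-inv Y p))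
  }

-- The grading

parity-suc : ∀ a → parity (suc a) ≢ parity a
parity-suc zero          ()
parity-suc (suc zero)    ()
parity-suc (suc (suc a)) = parity-suc a

position : Element m n → ℕ
position p = Element.i p + Element.j p

-- The rank `i + j - 2k` counted from the top, split so that neither subtraction truncates.
time : Element m n → ℕ
time p = (Element.i p ∸ Element.k p) + (Element.j p ∸ Element.k p)

∸-suc : ∀ {a b} → .(b < a) → a ∸ b ≡ suc (a ∸ suc b)
∸-suc {suc a} {zero}  _ = refl
∸-suc {suc a} {suc b} h = ∸-suc {a} {b} (s≤s⁻¹ h)

time-cover : {p q : Element m n} → p covers q → time q ≡ suc (time p)
time-cover {p = element i j k _ _ _ k≤i _} {element _ _ _ _ _ _ _ _} (down-i refl refl refl) =
  cong (_+ (j ∸ k)) (∸-suc {suc i} {k} (s≤s k≤i))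
time-cover {p = element i j k _ k≤j _ _ _} {element _ _ _ _ _ _ _ _} (down-j refl refl refl) =
  trans (cong ((i ∸ k) +_) (∸-suc {suc j} {k} (s≤s k≤j))) (+-suc (i ∸ k) _)
time-cover {p = element _ j _ _ k<j _ _ _} {element i _ k _ _ _ _ _} (down-ik refl refl refl) =
  trans (cong ((i ∸ k) +_) (∸-suc {j} {k} k<j)) (+-suc (i ∸ k) _)
time-cover {p = element i _ _ _ _ _ k<i _} {element _ j k _ _ _ _ _} (down-jk refl refl refl) =
  cong (_+ (j ∸ k)) (∸-suc {i} {k} k<i)

parity-time : (p : Element m n) → parity (position p) ≡ parity (time p)
parity-time (element i j k _ k≤j _ k≤i _) = go i j k k≤i k≤j
  where
  go : ∀ i j k → .(k ≤ i) → .(k ≤ j) → parity (i + j) ≡ parity ((i ∸ k) + (j ∸ k))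
  go i       j       zero    _ _ = refl
  go (suc i) (suc j) (suc k) h l =
    trans (cong (parity ∘ suc) (+-suc i j)) (go i j k (s≤s⁻¹ h) (s≤s⁻¹ l))

time-bound : (p : Element m n) → time p < m + n
time-bound {m} {n} (element i j k _ _ j<n _ i<m) =
  ≤-<-trans (+-mono-≤ (m∸n≤m i k) (m∸n≤m j k))
    (+-mono-< (recompute (i <? m) i<m) (recompute (j <? n) j<n))

parity-cover : {p q : Element m n} → p covers q → parity (position p) ≢ parity (position q)
parity-cover {p = p} {q} p⋗q h = parity-suc (time p)
  (trans (cong parity (sym (time-cover p⋗q)))
    (trans (sym (parity-time q)) (trans (sym h) (parity-time p))))

-- The two evolutions

parityClass : ∀ m n → Parity → IndependentSet m n
parityClass m n π = record
  { Member      = λ p → parity (position p) ≡ π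
  ; member?     = λ p → parity (position p) Parity.≟ π
  ; independent = λ p⋗q hp hq → parity-cover p⋗q (trans hp (sym hq))
  }

-- Step `t` restricted to elements whose own time has not come. The inequality is strict because an
-- element of time `t` must keep its value from before step `t`.
pending : ∀ m n → ℕ → IndependentSet m n
pending m n t = record
  { Member      = λ p → parity (position p) ≡ parity t × t < time p
  ; member?     = λ p → parity (position p) Parity.≟ parity t ×-dec t <? time p
  ; independent = λ p⋗q hp hq → parity-cover p⋗q (trans (proj₁ hp) (sym (proj₁ hq)))
  }

toggleParity : Parity → OrderIdeal m n → OrderIdeal m n
toggleParity π = toggle (parityClass _ _ π)

evolve : ℕ → OrderIdeal m n → OrderIdeal m n
evolve zero    X = X
evolve (suc t) X = toggleParity (parity t) (evolve t X)

-- The schedule of parities has period two, so starting two steps later shifts the whole evolution.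
evolve-2+ : ∀ t (X : OrderIdeal m n) → evolve t (evolve 2 X) ≡ evolve (2 + t) X
evolve-2+ zero    X = refl
evolve-2+ (suc t) X = cong (toggleParity (parity t)) (evolve-2+ t X)

shear : ℕ → Bijection (J-setoid m n) (J-setoid m n)
shear {m} {n} zero    = Identity.bijection (J-setoid m n)
shear {m} {n} (suc t) = Composition.bijection (shear t)
  (involution⇒bijection (toggle (pending m n t)) (λ {X} {Y} → toggle-cong (pending m n t) {X} {Y})
    (toggle-involutive (pending m n t)))

sheared : ℕ → OrderIdeal m n → OrderIdeal m n
sheared t = Bijection.to (shear t)

evolve-idle : ∀ t (X : OrderIdeal m n) p → parity (position p) ≢ parity t →
  member (evolve (suc t) X) p ≡ member (evolve t X) p
evolve-idle t X p h = toggleMember-no (parityClass _ _ (parity t)) (evolve t X) p (h ∘ proj₁)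

-- At stage `t` an element is either frozen at its own time or still in step with `evolve t X`; at
-- time exactly `t` both descriptions agree. A pending element has time above `t`, so its upper
-- covers have time at least `t` and all its neighbours are still in step. Its toggle is therefore
-- that of `evolve`.
sheared-evolve : ∀ t (X : OrderIdeal m n) p →
  (t ≤ time p → member (sheared t X) p ≡ member (evolve t X) p) ×
  (time p ≤ t → member (sheared t X) p ≡ member (evolve (time p) X) p)
sheared-evolve zero X p = (λ _ → refl) , (λ h → cong (λ s → member (evolve s X) p) (sym (n≤0⇒n≡0 h)))
sheared-evolve {m} {n} (suc t) X p = early , late
  where
  early : suc t ≤ time p → member (sheared (suc t) X) p ≡ member (evolve (suc t) X) p
  early t<p = by-cases (parity (position p) Parity.≟ parity t)
    where
    by-cases : Dec (parity (position p) ≡ parity t) →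
      member (sheared (suc t) X) p ≡ member (evolve (suc t) X) p
    by-cases (no h) =
      trans (toggleMember-no (pending m n t) (sheared t X) p (h ∘ proj₁ ∘ proj₁))
        (trans (proj₁ (sheared-evolve t X p) (<⇒≤ t<p)) (sym (evolve-idle t X p h)))
    by-cases (yes h) =
      toggleMember-local (pending m n t) (parityClass m n (parity t)) (sheared t X) (evolve t X) p
        (mk⇔ proj₁ (_, t<p))
        (proj₁ (sheared-evolve t X p) (<⇒≤ t<p))
        (λ q p⋗q → proj₁ (sheared-evolve t X q)
          (≤-trans (<⇒≤ t<p) (≤-trans (n≤1+n _) (≤-reflexive (sym (time-cover p⋗q))))))
        (λ q q⋗p → proj₁ (sheared-evolve t X q)
          (s≤s⁻¹ (≤-trans t<p (≤-reflexive (time-cover q⋗p)))))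

  late : time p ≤ suc t → member (sheared (suc t) X) p ≡ member (evolve (time p) X) p
  late p≤1+t with m≤n⇒m<n∨m≡n p≤1+t
  ... | inj₂ eq = trans (early (≤-reflexive (sym eq))) (cong (λ s → member (evolve s X) p) (sym eq))
  ... | inj₁ p<1+t =
    trans (toggleMember-no (pending m n t) (sheared t X) p (≤⇒≯ (s≤s⁻¹ p<1+t) ∘ proj₂ ∘ proj₁))
      (proj₂ (sheared-evolve t X p) (s≤s⁻¹ p<1+t))

-- All times are below `m + n` by `time-bound`, so after that many stages every element is frozen.
recombine : Bijection (J-setoid m n) (J-setoid m n)
recombine {m} {n} = shear (m + n)

recombined : OrderIdeal m n → OrderIdeal m n
recombined = Bijection.to recombine

member-recombined : ∀ (X : OrderIdeal m n) p →
  member (recombined X) p ≡ member (evolve (time p) X) p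
member-recombined {m} {n} X p = proj₂ (sheared-evolve (m + n) X p) (<⇒≤ (time-bound p))

-- Rowmotion on the slanted slice

module _ (X : OrderIdeal m n) where
  private
    Y Y′ : OrderIdeal m n
    Y  = recombined X
    Y′ = recombined (evolve 2 X)

    -- The slice reads `q` one step after time `time p`, and `q` has the wrong parity to move in
    -- that step.
    Y-lower : ∀ {p q} → p covers q → member Y q ≡ member (evolve (time p) X) q
    Y-lower {p} {q} p⋗q =
      trans (member-recombined X q)
        (trans (cong (λ s → member (evolve s X) q) (time-cover p⋗q))
          (evolve-idle (time p) X q
            (λ h → parity-cover p⋗q (trans (parity-time p) (sym h)))))

    Y′-evolve : ∀ p → member Y′ p ≡ member (evolve (2 + time p) X) p
    Y′-evolve p = trans (member-recombined (evolve 2 X) p)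
      (cong (λ Z → member Z p) (evolve-2+ (time p) X))

    -- The later slice reads `q` at time `2 + time q`, which is `1 + time p`; step `time p` leaves
    -- `q` alone.
    Y′-upper : ∀ {p q} → q covers p → member Y′ q ≡ member (evolve (time p) X) q
    Y′-upper {p} {q} q⋗p =
      trans (Y′-evolve q)
        (trans (cong (λ s → member (evolve (suc s) X) q) (sym (time-cover q⋗p)))
          (evolve-idle (time p) X q
            (λ h → parity-cover q⋗p (trans h (sym (parity-time p))))))

    Y′-toggle : ∀ p → member Y′ p ≡ toggleMember (parityClass m n (parity (time p))) (evolve (time p) X) p
    Y′-toggle p = trans (Y′-evolve p)
      (evolve-idle (suc (time p)) X p
        (λ h → parity-suc (time p) (trans (sym h) (parity-time p))))

    Generators : Pred (Element m n) 0ℓ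
    Generators = Minimal (Complement Y)

    minimal⇒lower : ∀ {r} → Generators r → ∀ q → r covers q → T (member Y q)
    minimal⇒lower {r} (_ , least) q r⋗q = decidable-stable (T? (member Y q)) λ ¬q →
      parity-cover r⋗q (cong (parity ∘ position) (sym (least q ¬q (r⋗q ◅ ε))))

    lower⇒minimal : ∀ {r} → ¬ T (member Y r) → (∀ q → r covers q → T (member Y q)) → Generators r
    lower⇒minimal {r} ¬r lower = ¬r , least
      where
      least : ∀ q → ¬ T (member Y q) → q ≤ᴾ r → q ≡ r
      least q ¬q ε            = refl
      least q ¬q (r⋗s ◅ s≥q)  = contradiction (closed Y s≥q (lower _ r⋗s)) ¬q

    -- Minimality puts the lower covers of `r` inside, and the state at `time r` is an ideal without
    -- `r`, so the upper covers are outside. Step `time r` therefore adds `r`.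
    generator⇒Y′ : ∀ {r} → Generators r → T (member Y′ r)
    generator⇒Y′ {r} g = subst T (sym Y′≡) (T-not⁺ ¬r)
      where
      ¬r : ¬ T (member (evolve (time r) X) r)
      ¬r = proj₁ g ∘ subst T (sym (member-recombined X r))

      toggleable : Toggleable (evolve (time r) X) r
      toggleable =
        (λ q r⋗q → subst T (Y-lower r⋗q) (minimal⇒lower g q r⋗q)) ,
        (λ q q⋗r h → ¬r (closed-cover (evolve (time r) X) q⋗r h))

      Y′≡ : member Y′ r ≡ not (member (evolve (time r) X) r)
      Y′≡ = trans (Y′-toggle r) (toggleMember-yes (parityClass m n _) _ r (parity-time r) toggleable)

    upper? : ∀ p → Dec (∃ λ q → q covers p × T (member Y′ q))
    upper? p = any-element? λ q → q covers? p ×-dec T? (member Y′ q)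

    -- Climb inside `Y′` until no cover above remains; each step up lowers the time, which `t`
    -- bounds. The element reached turns out to be a generator.
    Y′⇒generated : ∀ t p → time p ≤ t → T (member Y′ p) → Generated Generators p
    Y′⇒generated t p p≤t h = by-cases t p≤t (upper? p) (toggleable? (evolve (time p) X) p)
      where
      Result : Set
      Result = Generated Generators p

      by-cases : ∀ t → time p ≤ t → Dec (∃ λ q → q covers p × T (member Y′ q)) →
        Dec (Toggleable (evolve (time p) X) p) → Result
      by-cases zero    p≤t (yes (q , q⋗p , _))  _ = contradiction (≤-trans (≤-reflexive (sym (time-cover q⋗p))) p≤t) λ ()
      by-cases (suc t) p≤t (yes (q , q⋗p , hq)) _ =
        let (r , g , q≤r) = Y′⇒generated t q (s≤s⁻¹ (≤-trans (≤-reflexive (sym (time-cover q⋗p))) p≤t)) hq in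
        r , g , q≤r ◅◅ (q⋗p ◅ ε)
      by-cases _ _ (no _) (yes tog) = p , lower⇒minimal ¬p lower , ε
        where
        ¬p : ¬ T (member Y p)
        ¬p = T-not⁻ (subst T (trans (Y′-toggle p)
               (toggleMember-yes (parityClass m n _) _ p (parity-time p) tog)) h)
             ∘ subst T (member-recombined X p)

        lower : ∀ q → p covers q → T (member Y q)
        lower q p⋗q = subst T (sym (Y-lower p⋗q)) (proj₁ tog q p⋗q)
      -- An element kept by its step was already present, so closure supplies its lower covers. With
      -- no upper cover in `Y′` it would have been toggleable.
      by-cases _ _ (no ¬upper) (no ¬tog) = contradiction (lower , upper) ¬tog
        where
        p∈ : T (member (evolve (time p) X) p)
        p∈ = subst T (trans (Y′-toggle p) (toggleMember-no (parityClass m n _) _ p (¬tog ∘ proj₂))) h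

        lower : ∀ q → p covers q → T (member (evolve (time p) X) q)
        lower q p⋗q = closed-cover (evolve (time p) X) p⋗q p∈

        upper : ∀ q → q covers p → ¬ T (member (evolve (time p) X) q)
        upper q q⋗p hq = ¬upper (q , q⋗p , subst T (sym (Y′-upper q⋗p)) hq)

  rowmotion-recombined : recombined (evolve 2 X) ≈ rowmotion (recombined X)
  rowmotion-recombined p = T-injective
    (λ h → fromWitness {a? = generated? Y p} (Y′⇒generated (time p) p ≤-refl h))
    (λ h → let (r , g , p≤r) = toWitness {a? = generated? Y p} h in closed Y′ p≤r (generator⇒Y′ g))

-- Height functions

bit : Bool → ℕ
bit true  = 1
bit false = 0

bit-injective : ∀ {a b} → bit a ≡ bit b → a ≡ b
bit-injective {true}  {true}  _ = refl
bit-injective {false} {false} _ = refl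

bit+not : ∀ b → bit b + bit (not b) ≡ 1
bit+not true  = refl
bit+not false = refl

odd : ℕ → Bool
odd zero    = false
odd (suc a) = not (odd a)

odd⇔ : ∀ a → T (odd a) ⇔ parity a ≡ 1ℙ
odd⇔ a = mk⇔ (to a) (from a)
  where
  to : ∀ a → T (odd a) → parity a ≡ 1ℙ
  to 1             _ = refl
  to (suc (suc a)) h = to a (subst T (not-involutive (odd a)) h)

  from : ∀ a → parity a ≡ 1ℙ → T (odd a)
  from 1             _ = _
  from (suc (suc a)) h = subst T (sym (not-involutive (odd a))) (from a h)

even⇔ : ∀ a → T (not (odd a)) ⇔ parity a ≡ 0ℙ
even⇔ a = mk⇔ (to a) (from a)
  where
  to : ∀ a → T (not (odd a)) → parity a ≡ 0ℙ
  to 0             _ = refl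
  to (suc (suc a)) h = to a (subst (T ∘ not) (not-involutive (odd a)) h)

  from : ∀ a → parity a ≡ 0ℙ → T (not (odd a))
  from 0             _ = _
  from (suc (suc a)) h = subst (T ∘ not) (sym (not-involutive (odd a))) (from a h)

odd-+suc : ∀ i j → odd (i + suc j) ≡ not (odd (i + j))
odd-+suc i j = cong odd (+-suc i j)

xor-cancelʳ : ∀ {a b} c → a xor c ≡ b xor c → a ≡ b
xor-cancelʳ {true}  {true}  c _ = refl
xor-cancelʳ {false} {false} c _ = refl
xor-cancelʳ {true}  {false} true  ()
xor-cancelʳ {true}  {false} false ()
xor-cancelʳ {false} {true}  true  ()
xor-cancelʳ {false} {true}  false ()

xor-xor : ∀ a b → (a xor b) xor b ≡ a
xor-xor true  true  = refl
xor-xor true  false = refl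
xor-xor false true  = refl
xor-xor false false = refl

Height : Set
Height = ℕ → ℕ → ℕ

-- Heights live on squares.  The height rises by 0 or 1 across each edge when moving right or
-- down, according to whether the edge is present and to the parity of the square being left.
riseRight riseDown : Subgraph m n → ℕ → ℕ → ℕ
riseRight F i j = bit (hasVert F i (suc j) xor not (odd (i + j)))
riseDown  F i j = bit (hasHoriz F (suc i) j xor odd (i + j))

record Represents {m n : ℕ} (F : Subgraph m n) (c : Height) : Set where
  field
    top   : ∀ j → j ≤ n → c 0 j ≡ 0
    left  : ∀ i → i ≤ m → c i 0 ≡ 0
    right : ∀ i j → i ≤ m → j < n → c i (suc j) ≡ c i j + riseRight F i j
    down  : ∀ i j → i < m → j ≤ n → c (suc i) j ≡ c i j + riseDown F i j

all-bools? : {P : Bool → Set} → (∀ b → Dec (P b)) → Dec (∀ b → P b)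
all-bools? P? = map′ (λ { (f , t) false → f ; (f , t) true → t }) (λ h → h false , h true)
                     (P? false ×-dec P? true)

-- Both sides of the second equation climb from the upper left to the lower right square around a
-- vertex, where o is the parity of the former.
degree⇒closed : ∀ o up down left right →
  bit up + (bit down + (bit left + bit right)) ≡ 2 →
  bit (up xor not o) + bit (right xor not o) ≡ bit (left xor o) + bit (down xor not (not o))
degree⇒closed = toWitness {a? = all-bools? λ o → all-bools? λ u → all-bools? λ d →
  all-bools? λ l → all-bools? λ r → (_ ≟ 2) →-dec (_ ≟ _)} _

closed⇒degree : ∀ o up down left right →
  bit (up xor not o) + bit (right xor not o) ≡ bit (left xor o) + bit (down xor not (not o)) →
  bit up + (bit down + (bit left + bit right)) ≡ 2
closed⇒degree = toWitness {a? = all-bools? λ o → all-bools? λ u → all-bools? λ d →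
  all-bools? λ l → all-bools? λ r → (_ ≟ _) →-dec (_ ≟ 2)} _

length-filterᵇ : {A : Set} (f : A → Bool) (a : A) (as : List A) →
  length (filterᵇ f (a ∷ as)) ≡ bit (f a) + length (filterᵇ f as)
length-filterᵇ f a as with f a
... | true  = refl
... | false = refl

degree-sum : ∀ (F : Subgraph m n) i j .(p : 1 ≤ suc i) .(q : suc i ≤ m) .(r : 1 ≤ suc j) .(s : suc j ≤ n) →
  degree F (interior-vertex (suc i) (suc j) p q r s) ≡
  bit (hasVert F i (suc j)) + (bit (hasVert F (suc i) (suc j)) +
    (bit (hasHoriz F (suc i) j) + bit (hasHoriz F (suc i) (suc j))))
degree-sum F i j p q r s =
  trans (length-filterᵇ F _ _) (cong₂ _+_ (cong bit (sym (hasVert-edge F i (suc j) _ _ _)))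
    (trans (length-filterᵇ F _ _) (cong₂ _+_ (cong bit (sym (hasVert-edge F (suc i) (suc j) _ _ _)))
      (trans (length-filterᵇ F _ _) (cong₂ _+_ (cong bit (sym (hasHoriz-edge F (suc i) j _ _ _)))
        (trans (length-filterᵇ F _ _) (trans (+-identityʳ _)
          (cong bit (sym (hasHoriz-edge F (suc i) (suc j) _ _ _))))))))))

Closed : Subgraph m n → ℕ → ℕ → Set
Closed F i j = riseRight F i j + riseDown F i (suc j) ≡ riseDown F i j + riseRight F (suc i) j

-- One path around the vertex crosses the edges up and right, the other left and down, and the
-- parity complements the edges of exactly one path. Complementing two edges replaces their sum by
-- two minus it, so equal rises mean total degree two.
degree≡2⇔Closed : ∀ (F : Subgraph m n) i j .(p : 1 ≤ suc i) .(q : suc i ≤ m) .(r : 1 ≤ suc j) .(s : suc j ≤ n) →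
  degree F (interior-vertex (suc i) (suc j) p q r s) ≡ 2 ⇔ Closed F i j
degree≡2⇔Closed F i j p q r s = mk⇔
  (λ d → trans (cong (riseRight F i j +_) turn)
    (degree⇒closed (odd (i + j)) up down left right (trans (sym (degree-sum F i j p q r s)) d)))
  (λ c → trans (degree-sum F i j p q r s)
    (closed⇒degree (odd (i + j)) up down left right (trans (cong (riseRight F i j +_) (sym turn)) c)))
  where
  up    = hasVert F i (suc j)
  down  = hasVert F (suc i) (suc j)
  left  = hasHoriz F (suc i) j
  right = hasHoriz F (suc i) (suc j)

  turn : riseDown F i (suc j) ≡ bit (right xor not (odd (i + j)))
  turn = cong (λ o → bit (right xor o)) (odd-+suc i j)

T⇔≡ : ∀ {a b} {P : Set} → T a ⇔ P → T b ⇔ P → a ≡ b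
T⇔≡ f g = T-injective (Equivalence.from g ∘ Equivalence.to f) (Equivalence.from f ∘ Equivalence.to g)

-- Summing down the columns makes the rules `top` and `down` of `Represents` hold by definition;
-- `left` and `right` come from the configuration conditions.
height : Subgraph m n → Height
height F zero    j = 0
height F (suc i) j = height F i j + riseDown F i j

module _ {F : Subgraph m n} (F-isPFPL : IsPFPL F) where
  open IsPFPL F-isPFPL

  private
    top-edge : ∀ j → j < n → hasVert F 0 (suc j) ≡ not (odd j)
    top-edge j j<n = trans (hasVert-edge F 0 (suc j) z≤n (s≤s z≤n) j<n)
      (T⇔≡ (top (suc j) (s≤s z≤n) j<n) (odd⇔ (suc j)))

    left-edge : ∀ i → i < m → hasHoriz F (suc i) 0 ≡ odd i
    left-edge i i<m = trans (hasHoriz-edge F (suc i) 0 (s≤s z≤n) i<m z≤n)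
      (trans (T⇔≡ (left (suc i) (s≤s z≤n) i<m) (even⇔ (suc i))) (not-involutive (odd i)))

    xor-self : ∀ b → bit (b xor b) ≡ 0
    xor-self true  = refl
    xor-self false = refl

    height-left : ∀ i → i ≤ m → height F i 0 ≡ 0
    height-left zero    _   = refl
    height-left (suc i) i<m = cong₂ _+_ (height-left i (<⇒≤ i<m))
      (trans (cong₂ (λ a b → bit (a xor odd b)) (left-edge i i<m) (+-identityʳ i)) (xor-self (odd i)))

    -- Induction on the row: the top boundary edges give a flat first row, and the degree condition
    -- at each vertex carries the rule to the next row.
    height-right : ∀ i j → i ≤ m → j < n →
      height F i (suc j) ≡ height F i j + riseRight F i j
    height-right zero    j _   j<n =
      sym (trans (cong (λ a → bit (a xor not (odd j))) (top-edge j j<n)) (xor-self (not (odd j))))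
    height-right (suc i) j i<m j<n = begin
      height F i (suc j) + riseDown F i (suc j)
        ≡⟨ cong (_+ riseDown F i (suc j)) (height-right i j (<⇒≤ i<m) j<n) ⟩
      height F i j + riseRight F i j + riseDown F i (suc j)
        ≡⟨ +-assoc (height F i j) _ _ ⟩
      height F i j + (riseRight F i j + riseDown F i (suc j))
        ≡⟨ cong (height F i j +_) (Equivalence.to (degree≡2⇔Closed F i j (s≤s z≤n) i<m (s≤s z≤n) j<n)
             (two (interior-vertex (suc i) (suc j) (s≤s z≤n) i<m (s≤s z≤n) j<n))) ⟩
      height F i j + (riseDown F i j + riseRight F (suc i) j)
        ≡⟨ +-assoc (height F i j) _ _ ⟨
      height F (suc i) j + riseRight F (suc i) j ∎
      where open ≡-Reasoning

  represents-height : Represents F (height F)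
  represents-height = record
    { top   = λ _ _ → refl
    ; left  = height-left
    ; right = height-right
    ; down  = λ _ _ _ _ → refl
    }

represents-unique : ∀ {F : Subgraph m n} {c c′} → Represents F c → Represents F c′ →
  ∀ i j → i ≤ m → j ≤ n → c i j ≡ c′ i j
represents-unique R R′ zero    j _   j≤n = trans (Represents.top R j j≤n) (sym (Represents.top R′ j j≤n))
represents-unique {F = F} R R′ (suc i) j i<m j≤n =
  trans (Represents.down R i j i<m j≤n)
    (trans (cong (_+ riseDown F i j)
             (represents-unique R R′ i j (<⇒≤ i<m) j≤n))
      (sym (Represents.down R′ i j i<m j≤n)))

subgraph-unique : ∀ {F F′ : Subgraph m n} {c c′} → Represents F c → Represents F′ c′ →
  (∀ i j → i ≤ m → j ≤ n → c i j ≡ c′ i j) → ∀ e → F e ≡ F′ e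
subgraph-unique R R′ c≗c′ (vert i zero _ 1≤j _) = contradiction-irr 1≤j λ ()
subgraph-unique {m} {n} {F} {F′} {c} R R′ c≗c′ (vert i (suc j) p q r) =
  trans (sym (hasVert-edge F i (suc j) p q r))
    (trans (xor-cancelʳ _ (bit-injective (+-cancelˡ-≡ (c i j) _ _
      (trans (sym (Represents.right R i j i≤m j<n))
        (trans (c≗c′ i (suc j) i≤m j<n)
          (trans (Represents.right R′ i j i≤m j<n)
            (cong (_+ riseRight F′ i j) (sym (c≗c′ i j i≤m (<⇒≤ j<n))))))))))
      (hasVert-edge F′ i (suc j) p q r))
  where
  i≤m = recompute (i ≤? m) p
  j<n = recompute (j <? n) r
subgraph-unique R R′ c≗c′ (horiz zero j 1≤i _ _) = contradiction-irr 1≤i λ ()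
subgraph-unique {m} {n} {F} {F′} {c} R R′ c≗c′ (horiz (suc i) j p q r) =
  trans (sym (hasHoriz-edge F (suc i) j p q r))
    (trans (xor-cancelʳ _ (bit-injective (+-cancelˡ-≡ (c i j) _ _
      (trans (sym (Represents.down R i j i<m j≤n))
        (trans (c≗c′ (suc i) j i<m j≤n)
          (trans (Represents.down R′ i j i<m j≤n)
            (cong (_+ riseDown F′ i j) (sym (c≗c′ i j (<⇒≤ i<m) j≤n)))))))))
      (hasHoriz-edge F′ (suc i) j p q r))
  where
  i<m = recompute (i <? m) q
  j≤n = recompute (j ≤? n) r

hasVert-cong : ∀ {F F′ : Subgraph m n} → (∀ e → F e ≡ F′ e) → ∀ i j → hasVert F i j ≡ hasVert F′ i j
hasVert-cong {m} {n} F≗F′ i j with i ≤? m ×-dec 1 ≤? j ×-dec j ≤? n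
... | yes _ = F≗F′ _
... | no _  = refl

hasHoriz-cong : ∀ {F F′ : Subgraph m n} → (∀ e → F e ≡ F′ e) → ∀ i j → hasHoriz F i j ≡ hasHoriz F′ i j
hasHoriz-cong {m} {n} F≗F′ i j with 1 ≤? i ×-dec i ≤? m ×-dec j ≤? n
... | yes _ = F≗F′ _
... | no _  = refl

height-cong : ∀ {F F′ : Subgraph m n} → (∀ e → F e ≡ F′ e) → ∀ i j → height F i j ≡ height F′ i j
height-cong F≗F′ zero    j = refl
height-cong {F′ = F′} F≗F′ (suc i) j =
  cong₂ (λ a b → a + bit (b xor odd (i + j))) (height-cong F≗F′ i j) (hasHoriz-cong {F′ = F′} F≗F′ (suc i) j)

record IsHeight (m n : ℕ) (c : Height) : Set where
  field
    top   : ∀ j → j ≤ n → c 0 j ≡ 0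
    left  : ∀ i → i ≤ m → c i 0 ≡ 0
    right : ∀ i j → i ≤ m → j < n → ∃ λ b → c i (suc j) ≡ c i j + bit b
    down  : ∀ i j → i < m → j ≤ n → ∃ λ b → c (suc i) j ≡ c i j + bit b

represents⇒isHeight : ∀ {F : Subgraph m n} {c} → Represents F c → IsHeight m n c
represents⇒isHeight R = record
  { top   = Represents.top R
  ; left  = Represents.left R
  ; right = λ i j p q → _ , Represents.right R i j p q
  ; down  = λ i j p q → _ , Represents.down R i j p q
  }

bit≤1 : ∀ b → bit b ≤ 1
bit≤1 true  = ≤-refl
bit≤1 false = z≤n

m+bit≤1+m : ∀ a b → a + bit b ≤ suc a
m+bit≤1+m a b = ≤-trans (+-monoʳ-≤ a (bit≤1 b)) (≤-reflexive (+-comm a 1))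

m<ᵇm+bit : ∀ a b → (a <ᵇ a + bit b) ≡ b
m<ᵇm+bit zero    true  = refl
m<ᵇm+bit zero    false = refl
m<ᵇm+bit (suc a) b     = m<ᵇm+bit a b

module _ {c : Height} (h : IsHeight m n c) where
  open IsHeight h

  height-right-≤ : ∀ i j → i ≤ m → j < n → c i j ≤ c i (suc j)
  height-right-≤ i j p q = ≤-trans (m≤m+n _ _) (≤-reflexive (sym (proj₂ (right i j p q))))

  height-right-≤suc : ∀ i j → i ≤ m → j < n → c i (suc j) ≤ suc (c i j)
  height-right-≤suc i j p q =
    ≤-trans (≤-reflexive (proj₂ (right i j p q))) (m+bit≤1+m (c i j) (proj₁ (right i j p q)))

  height-down-≤ : ∀ i j → i < m → j ≤ n → c i j ≤ c (suc i) j
  height-down-≤ i j p q = ≤-trans (m≤m+n _ _) (≤-reflexive (sym (proj₂ (down i j p q))))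

  height-down-≤suc : ∀ i j → i < m → j ≤ n → c (suc i) j ≤ suc (c i j)
  height-down-≤suc i j p q =
    ≤-trans (≤-reflexive (proj₂ (down i j p q))) (m+bit≤1+m (c i j) (proj₁ (down i j p q)))

  -- Together with `height≤col` this turns `k` being below a height into the bounds `k ≤ i` and
  -- `k ≤ j` of a poset element.
  height≤row : ∀ i j → i ≤ m → j ≤ n → c i j ≤ i
  height≤row zero    j _ q = ≤-reflexive (top j q)
  height≤row (suc i) j p q = ≤-trans (height-down-≤suc i j p q) (s≤s (height≤row i j (<⇒≤ p) q))

  height≤col : ∀ i j → i ≤ m → j ≤ n → c i j ≤ j
  height≤col i zero    p _ = ≤-reflexive (left i p)
  height≤col i (suc j) p q = ≤-trans (height-right-≤suc i j p q) (s≤s (height≤col i j p (<⇒≤ q)))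

-- The subgraph represented by a height function

graph : Height → Subgraph m n
graph c (vert  i j _ _ _) = (c i (pred j) <ᵇ c i j) xor not (odd (i + pred j))
graph c (horiz i j _ _ _) = (c (pred i) j <ᵇ c i j) xor odd (pred i + j)

module _ {c : Height} (h : IsHeight m n c) where
  open IsHeight h

  private
    F : Subgraph m n
    F = graph c

    -- Comparing consecutive heights recovers the rise, and the parity twist is its own inverse.
    step : ∀ {a a′ b} o e → e ≡ (a <ᵇ a′) xor o → a′ ≡ a + bit b → a′ ≡ a + bit (e xor o)
    step {a} {a′} {b} o e e≡ a′≡ = trans a′≡ (cong (λ x → a + bit x) (sym
      (trans (cong (_xor o) e≡) (trans (xor-xor (a <ᵇ a′) o)
        (trans (cong (a <ᵇ_) a′≡) (m<ᵇm+bit a b))))))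

  represents-graph : Represents F c
  represents-graph = record
    { top   = top
    ; left  = left
    ; right = λ i j p q → step (not (odd (i + j))) (hasVert F i (suc j))
                (hasVert-edge F i (suc j) p (s≤s z≤n) q) (proj₂ (right i j p q))
    ; down  = λ i j p q → step (odd (i + j)) (hasHoriz F (suc i) j)
                (hasHoriz-edge F (suc i) j (s≤s z≤n) p q) (proj₂ (down i j p q))
    }

  isPFPL-graph : IsPFPL F
  isPFPL-graph = record { two = two ; top = top-edge ; left = left-edge }
    where
    module R = Represents represents-graph

    closes : ∀ i j → i < m → j < n → Closed F i j
    closes i j i<m j<n = +-cancelˡ-≡ (c i j) _ _ (begin
      c i j + (riseRight F i j + riseDown F i (suc j)) ≡⟨ +-assoc (c i j) _ _ ⟨
      c i j + riseRight F i j + riseDown F i (suc j)   ≡⟨ cong (_+ riseDown F i (suc j)) (R.right i j (<⇒≤ i<m) j<n) ⟨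
      c i (suc j) + riseDown F i (suc j)               ≡⟨ R.down i (suc j) i<m j<n ⟨
      c (suc i) (suc j)                                ≡⟨ R.right (suc i) j i<m j<n ⟩
      c (suc i) j + riseRight F (suc i) j              ≡⟨ cong (_+ riseRight F (suc i) j) (R.down i j i<m (<⇒≤ j<n)) ⟩
      c i j + riseDown F i j + riseRight F (suc i) j   ≡⟨ +-assoc (c i j) _ _ ⟩
      c i j + (riseDown F i j + riseRight F (suc i) j) ∎)
      where open ≡-Reasoning

    two : ∀ v → degree F v ≡ 2
    two (interior-vertex zero    _       p _ _ _) = contradiction-irr p λ ()
    two (interior-vertex (suc i) zero    _ _ r _) = contradiction-irr r λ ()
    two (interior-vertex (suc i) (suc j) p q r s) =
      Equivalence.from (degree≡2⇔Closed F i j p q r s)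
        (closes i j (recompute (i <? m) q) (recompute (j <? n) s))

    flat : ∀ {a b} → a ≡ 0 → b ≡ 0 → (a <ᵇ b) ≡ false
    flat refl refl = refl

    top-edge : ∀ j (1≤j : 1 ≤ j) (j≤n : j ≤ n) → T (F (vert 0 j z≤n 1≤j j≤n)) ⇔ parity j ≡ 1ℙ
    top-edge (suc j) 1≤j j<n = subst (λ b → T b ⇔ parity (suc j) ≡ 1ℙ)
      (cong (_xor not (odd j)) (sym (flat (top j (<⇒≤ j<n)) (top (suc j) j<n)))) (odd⇔ (suc j))

    left-edge : ∀ i (1≤i : 1 ≤ i) (i≤m : i ≤ m) → T (F (horiz i 0 1≤i i≤m z≤n)) ⇔ parity i ≡ 0ℙ
    left-edge (suc i) 1≤i i<m = subst (λ b → T b ⇔ parity (suc i) ≡ 0ℙ)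
      (trans (not-involutive (odd i)) (cong₂ (λ b a → b xor odd a)
        (sym (flat (left i (<⇒≤ i<m)) (left (suc i) i<m))) (sym (+-identityʳ i)))) (even⇔ (suc i))

-- Height functions and order ideals

ideal : (c : Height) → IsHeight m n c → OrderIdeal m n
ideal {m} {n} c h .member p = Element.k p <ᵇ c (suc (Element.i p)) (suc (Element.j p))
ideal {m} {n} c h .closed = down-closed (ideal c h .member) step
  where
  -- Covers that keep `k` rely on heights not decreasing; covers that lower `k` rely on heights
  -- rising by at most one.
  step : {p q : Element m n} → p covers q → T (ideal c h .member p) → T (ideal c h .member q)
  step {element i j k _ _ j<n _ _} {element _ _ _ _ _ _ _ i<m} (down-i refl refl refl) x =
    <⇒<ᵇ (<-≤-trans (<ᵇ⇒< _ _ x)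
      (height-down-≤ h (suc i) (suc j) (recompute (_ <? m) i<m) (recompute (j <? n) j<n)))
  step {element i j k _ _ _ _ i<m} {element _ _ _ _ _ j<n _ _} (down-j refl refl refl) x =
    <⇒<ᵇ (<-≤-trans (<ᵇ⇒< _ _ x)
      (height-right-≤ h (suc i) (suc j) (recompute (i <? m) i<m) (recompute (_ <? n) j<n)))
  step {element _ j _ _ _ j<n _ i<m} {element i _ k _ _ _ _ _} (down-ik refl refl refl) x =
    <⇒<ᵇ (s≤s⁻¹ (<-≤-trans (<ᵇ⇒< _ _ x)
      (height-down-≤suc h (suc i) (suc j) (recompute (_ <? m) i<m) (recompute (j <? n) j<n))))
  step {element i _ _ _ _ j<n _ i<m} {element _ j k _ _ _ _ _} (down-jk refl refl refl) x =
    <⇒<ᵇ (s≤s⁻¹ (<-≤-trans (<ᵇ⇒< _ _ x)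
      (height-right-≤suc h (suc i) (suc j) (recompute (i <? m) i<m) (recompute (_ <? n) j<n))))

≤-from-< : ∀ {a b} → (∀ k → k < a → k < b) → a ≤ b
≤-from-< {zero}  h = z≤n
≤-from-< {suc a} h = h a ≤-refl

ideal-≤ : ∀ {c c′} (h : IsHeight m n c) (h′ : IsHeight m n c′) → ideal c h ≈ ideal c′ h′ →
  ∀ i j → i ≤ m → j ≤ n → c i j ≤ c′ i j
ideal-≤ h h′ eq zero    j       _ q = ≤-trans (≤-reflexive (IsHeight.top h j q)) z≤n
ideal-≤ h h′ eq (suc i) zero    p _ = ≤-trans (≤-reflexive (IsHeight.left h (suc i) p)) z≤n
ideal-≤ h h′ eq (suc i) (suc j) p q = ≤-from-< λ k k<c →
  let k≤i = s≤s⁻¹ (<-≤-trans k<c (height≤row h (suc i) (suc j) p q))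
      k≤j = s≤s⁻¹ (<-≤-trans k<c (height≤col h (suc i) (suc j) p q))
  in <ᵇ⇒< _ _ (subst T (eq (element i j k (≤-<-trans k≤i p) k≤j q k≤i p)) (<⇒<ᵇ k<c))

ideal-injective : ∀ {c c′} (h : IsHeight m n c) (h′ : IsHeight m n c′) → ideal c h ≈ ideal c′ h′ →
  ∀ i j → i ≤ m → j ≤ n → c i j ≡ c′ i j
ideal-injective h h′ eq i j p q =
  ≤-antisym (ideal-≤ h h′ eq i j p q) (ideal-≤ h′ h (sym ∘ eq) i j p q)

-- The scan runs downwards and stops at the first success, which gives the number of solutions below
-- the bound for a downward closed `P`.
count : {P : ℕ → Set} → Decidable P → ℕ → ℕ
count P? zero    = 0
count P? (suc N) with P? N
... | yes _ = suc N
... | no  _ = count P? N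

count≤ : ∀ {P : ℕ → Set} (P? : Decidable P) N → count P? N ≤ N
count≤ P? zero    = z≤n
count≤ P? (suc N) with P? N
... | yes _ = ≤-refl
... | no  _ = m≤n⇒m≤1+n (count≤ P? N)

<count⁻ : ∀ {P : ℕ → Set} (P? : Decidable P) → (∀ k → P (suc k) → P k) →
  ∀ N {k} → k < count P? N → P k
<count⁻ P? closed-P (suc N) {k} k<c with P? N
... | no  _  = <count⁻ P? closed-P N k<c
... | yes PN = descend N PN (s≤s⁻¹ k<c)
  where
  descend : ∀ N → _ → k ≤ N → _
  descend N PN k≤N with m≤n⇒m<n∨m≡n k≤N
  ... | inj₂ refl = PN
  descend (suc N) PN k≤N | inj₁ k<N = descend N (closed-P N PN) (s≤s⁻¹ k<N)

<count⁺ : ∀ {P : ℕ → Set} (P? : Decidable P) N {k} → k < N → P k → k < count P? N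
<count⁺ P? (suc N) {k} k<N Pk with P? N
... | yes _  = k<N
... | no ¬PN with m≤n⇒m<n∨m≡n (s≤s⁻¹ k<N)
...   | inj₁ k<N′ = <count⁺ P? N k<N′ Pk
...   | inj₂ refl = contradiction Pk ¬PN

-- Extends membership to all natural triples, those outside the poset counting as absent, so that
-- `count` can scan over `k`.
record Contains (X : OrderIdeal m n) (i j k : ℕ) : Set where
  constructor contains
  field
    .k<m : k < m
    .k≤j : k ≤ j
    .j<n : j < n
    .k≤i : k ≤ i
    .i<m : i < m
    present : T (member X (element i j k k<m k≤j j<n k≤i i<m))

contains? : (X : OrderIdeal m n) → ∀ i j k → Dec (Contains X i j k)
contains? {m} {n} X i j k with (k <? m) ×-dec (k ≤? j) ×-dec (j <? n) ×-dec (k ≤? i) ×-dec (i <? m)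
... | no ¬h = no λ { (contains a b c d e _) → contradiction-irr (a , b , c , d , e) ¬h }
... | yes (a , b , c , d , e) = map′ (contains a b c d e) Contains.present (T? _)

module _ {X : OrderIdeal m n} where

  contains-down : ∀ {i j k} → suc i < m → Contains X i j k → Contains X (suc i) j k
  contains-down i<m (contains a b c d e h) =
    contains a b c (m≤n⇒m≤1+n d) i<m (closed-cover X (down-i refl refl refl) h)

  contains-right : ∀ {i j k} → suc j < n → Contains X i j k → Contains X i (suc j) k
  contains-right j<n (contains a b c d e h) =
    contains a (m≤n⇒m≤1+n b) j<n d e (closed-cover X (down-j refl refl refl) h)

  contains-up : ∀ {i j k} → Contains X (suc i) j (suc k) → Contains X i j k
  contains-up (contains a b c d e h) =
    contains (<⇒≤ a) (<⇒≤ b) c (s≤s⁻¹ d) (<⇒≤ e) (closed-cover X (down-ik refl refl refl) h)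

  contains-left : ∀ {i j k} → Contains X i (suc j) (suc k) → Contains X i j k
  contains-left (contains a b c d e h) =
    contains (<⇒≤ a) (s≤s⁻¹ b) (<⇒≤ c) (<⇒≤ d) e (closed-cover X (down-jk refl refl refl) h)

  -- Lowering `k` alone is not a cover but a composite of two: first `i` and `k` drop together, then
  -- `i` returns.
  contains-pred : ∀ {i j} k → Contains X i j (suc k) → Contains X i j k
  contains-pred {zero}  k (contains _ _ _ d _ _) = contradiction-irr d λ ()
  contains-pred {suc i} k c@(contains _ _ _ _ e _) = contains-down (recompute (_ <? _) e) (contains-up c)

  contains-row : ∀ {i j k} → Contains X i j k → k ≤ i
  contains-row (contains _ _ _ d _ _) = recompute (_ ≤? _) d

  contains-column : ∀ {i j k} → Contains X i j k → k ≤ j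
  contains-column (contains _ b _ _ _ _) = recompute (_ ≤? _) b

idealHeight : OrderIdeal m n → Height
idealHeight X zero    _       = 0
idealHeight X (suc i) zero    = 0
idealHeight X (suc i) (suc j) = count (contains? X i j) (suc i)

<idealHeight⁻ : ∀ (X : OrderIdeal m n) i j {k} → k < idealHeight X (suc i) (suc j) → Contains X i j k
<idealHeight⁻ X i j = <count⁻ (contains? X i j) (λ k → contains-pred k) (suc i)

<idealHeight⁺ : ∀ (X : OrderIdeal m n) i j {k} → Contains X i j k → k < idealHeight X (suc i) (suc j)
<idealHeight⁺ X i j {k} c =
  <count⁺ (contains? X i j) (suc i) (s≤s (contains-row c)) c

between : ∀ {a b} → a ≤ b → b ≤ suc a → ∃ λ x → b ≡ a + bit x
between {a} a≤b b≤1+a with m≤n⇒m<n∨m≡n a≤b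
... | inj₁ a<b = true , trans (≤-antisym b≤1+a a<b) (+-comm 1 a)
... | inj₂ a≡b = false , trans (sym a≡b) (sym (+-identityʳ a))

≤suc-from-< : ∀ {a b} → (∀ k → suc k < b → k < a) → b ≤ suc a
≤suc-from-< {b = zero}  h = z≤n
≤suc-from-< {b = suc b} h = s≤s (≤-from-< λ k k<b → h k (s≤s k<b))

-- The covers that keep `k` bound each step from below, those that lower `k` bound it by one. Next
-- to the zero row and column, the ranges of `k` already limit the height to one.
isHeight-idealHeight : (X : OrderIdeal m n) → IsHeight m n (idealHeight X)
isHeight-idealHeight {m} {n} X = record { top = λ _ _ → refl ; left = left ; right = right ; down = down }
  where
  left : ∀ i → i ≤ m → idealHeight X i 0 ≡ 0
  left zero    _ = refl
  left (suc i) _ = refl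

  column : ∀ i j → idealHeight X (suc i) (suc j) ≤ suc j
  column i j = ≤-from-< λ k k<h → s≤s (contains-column (<idealHeight⁻ X i j k<h))

  right : ∀ i j → i ≤ m → j < n → ∃ λ b → idealHeight X i (suc j) ≡ idealHeight X i j + bit b
  right zero    j       _   _   = false , refl
  right (suc i) zero    _   _   = between z≤n (column i zero)
  right (suc i) (suc j) i<m j<n = between
    (≤-from-< λ k k<h → <idealHeight⁺ X i (suc j) (contains-right j<n (<idealHeight⁻ X i j k<h)))
    (≤suc-from-< λ k k<h → <idealHeight⁺ X i j (contains-left (<idealHeight⁻ X i (suc j) k<h)))

  down : ∀ i j → i < m → j ≤ n → ∃ λ b → idealHeight X (suc i) j ≡ idealHeight X i j + bit b
  down i       zero    i<m _   = false , sym (trans (+-identityʳ _) (left i (<⇒≤ i<m)))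
  down zero    (suc j) _   _   = between z≤n (count≤ (contains? X zero j) 1)
  down (suc i) (suc j) i<m j<n = between
    (≤-from-< λ k k<h → <idealHeight⁺ X (suc i) j (contains-down i<m (<idealHeight⁻ X i j k<h)))
    (≤suc-from-< λ k k<h → <idealHeight⁺ X i j (contains-up (<idealHeight⁻ X (suc i) j k<h)))

ideal-idealHeight : (X : OrderIdeal m n) → ideal (idealHeight X) (isHeight-idealHeight X) ≈ X
ideal-idealHeight X (element i j k a b c d e) = T-injective
  (λ h → Contains.present (<idealHeight⁻ X i j (<ᵇ⇒< _ _ h)))
  (λ h → <⇒<ᵇ (<idealHeight⁺ X i j (contains a b c d e h)))

-- The bijection between configurations and order ideals

pfplHeight : PFPL m n → Height
pfplHeight F = height (subgraph F)

represents : (F : PFPL m n) → Represents (subgraph F) (pfplHeight F)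
represents F = represents-height (isPFPL F)

isHeight : (F : PFPL m n) → IsHeight m n (pfplHeight F)
isHeight F = represents⇒isHeight (represents F)

encode : PFPL m n → OrderIdeal m n
encode F = ideal (pfplHeight F) (isHeight F)

encode-bijection : Bijection (PFPL-setoid m n) (J-setoid m n)
encode-bijection {m} {n} = record
  { to = encode
  ; cong = λ {F} {F′} → encode-cong {F} {F′}
  ; bijective =
      (λ {F} {F′} eq → subgraph-unique (represents F) (represents F′)
        (ideal-injective (isHeight F) (isHeight F′) eq)) ,
      (λ X → decode X , λ {F} eq p → trans (encode-cong {F} {decode X} eq p) (encode-decode X p))
  }
  where
  encode-cong : {F F′ : PFPL m n} → (∀ e → subgraph F e ≡ subgraph F′ e) → encode F ≈ encode F′
  encode-cong {F} {F′} eq p = cong (Element.k p <ᵇ_) (height-cong eq (suc (Element.i p)) (suc (Element.j p)))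

  decode : OrderIdeal m n → PFPL m n
  decode X = pfpl (graph (idealHeight X)) (isPFPL-graph (isHeight-idealHeight X))

  encode-decode : ∀ X → encode (decode X) ≈ X
  encode-decode X p@(element i j k _ _ j<n _ i<m) = trans
    (cong (k <ᵇ_) (represents-unique (represents (decode X)) (represents-graph (isHeight-idealHeight X))
      (suc i) (suc j) (recompute (i <? m) i<m) (recompute (j <? n) j<n)))
    (ideal-idealHeight X p)

-- The local action as a toggle of heights

kindOf : Bool → Bool → Kind
kindOf D R = if D then (if R then interior else rightExterior) else (if R then bottomExterior else corner)

-- D and R tell whether the square has a bottom and a right side.
Flippable : Bool → Bool → Sides → Set
Flippable D R ⟨T t ,B b ,L l ,R r ⟩ = l ≡ not t × (T D → b ≡ t) × (T R → r ≡ not t)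

flippable? : ∀ D R s → Dec (Flippable D R s)
flippable? D R ⟨T t ,B b ,L l ,R r ⟩ =
  l Bool.≟ not t ×-dec (T? D →-dec b Bool.≟ t) ×-dec (T? R →-dec r Bool.≟ not t)

Flipped : Bool → Bool → Sides → Sides → Set
Flipped D R ⟨T t ,B b ,L l ,R r ⟩ ⟨T t′ ,B b′ ,L l′ ,R r′ ⟩ =
  t′ ≡ not t × l′ ≡ not l × (T D → b′ ≡ not b) × (T R → r′ ≡ not r)

Unchanged : Sides → Sides → Set
Unchanged ⟨T t ,B b ,L l ,R r ⟩ ⟨T t′ ,B b′ ,L l′ ,R r′ ⟩ = t′ ≡ t × b′ ≡ b × l′ ≡ l × r′ ≡ r

-- The masks encode that a missing side reads as absent, which is what the exterior patterns of
-- `swap` demand. What remains is a finite check.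
swap-flips : ∀ D R t b l r → Flippable D R ⟨T t ,B D ∧ b ,L l ,R R ∧ r ⟩ →
  Flipped D R ⟨T t ,B D ∧ b ,L l ,R R ∧ r ⟩ (swap (kindOf D R) ⟨T t ,B D ∧ b ,L l ,R R ∧ r ⟩)
swap-flips = toWitness {a? = all-bools? λ D → all-bools? λ R →
  all-bools? λ t → all-bools? λ b → all-bools? λ l → all-bools? λ r → flippable? D R _ →-dec
    (_ Bool.≟ _ ×-dec _ Bool.≟ _ ×-dec (T? D →-dec _ Bool.≟ _) ×-dec (T? R →-dec _ Bool.≟ _))} _

swap-fixes : ∀ D R t b l r → ¬ Flippable D R ⟨T t ,B D ∧ b ,L l ,R R ∧ r ⟩ →
  Unchanged ⟨T t ,B D ∧ b ,L l ,R R ∧ r ⟩ (swap (kindOf D R) ⟨T t ,B D ∧ b ,L l ,R R ∧ r ⟩)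
swap-fixes = toWitness {a? = all-bools? λ D → all-bools? λ R →
  all-bools? λ t → all-bools? λ b → all-bools? λ l → all-bools? λ r → ¬? (flippable? D R _) →-dec
    (_ Bool.≟ _ ×-dec _ Bool.≟ _ ×-dec _ Bool.≟ _ ×-dec _ Bool.≟ _)} _

-- u, l, d, r are the heights of the squares above, left of, below and right of a square of
-- height c with sides s, and o is the parity of the former two.
record Around (D R o : Bool) (u l d r : ℕ) (s : Sides) (c : ℕ) : Set where
  constructor around
  open Sides s
  field
    from-up   : c ≡ u + bit (top xor o)
    from-left : c ≡ l + bit (left xor not o)
    to-down   : T D → d ≡ c + bit (bottom xor not o)
    to-right  : T R → r ≡ c + bit (right xor not (not o))

-- The case in which the neighbours leave the square a choice: both `u` and `suc u` fit between
-- them. A missing neighbour imposes nothing.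
Extremal : Bool → Bool → ℕ → ℕ → ℕ → ℕ → Set
Extremal D R u l d r = l ≡ u × (T D → d ≡ suc u) × (T R → r ≡ suc u)

-- The sum `suc (u + u)` of the two admissible heights expresses, symmetrically in `c` and `v`, that
-- each is the other choice.
IsToggle : Bool → Bool → ℕ → ℕ → ℕ → ℕ → ℕ → ℕ → Set
IsToggle D R u l d r c v =
  (Extremal D R u l d r → c + v ≡ suc (u + u)) × (¬ Extremal D R u l d r → v ≡ c)

+bit+bit-not : ∀ a x → a + bit x + bit (not x) ≡ suc a
+bit+bit-not a x = trans (+-assoc a _ _) (trans (cong (a +_) (bit+not x)) (+-comm a 1))

+bit+bit≡1+⇒not : ∀ a x y → a + bit x + bit y ≡ suc a → y ≡ not x
+bit+bit≡1+⇒not a true  true  h = contradiction (+-cancelˡ-≡ a 2 1 (trans (sym (+-assoc a 1 1)) (trans h (+-comm 1 a)))) λ ()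
+bit+bit≡1+⇒not a true  false _ = refl
+bit+bit≡1+⇒not a false true  _ = refl
+bit+bit≡1+⇒not a false false h = contradiction (+-cancelˡ-≡ a 0 1 (trans (sym (+-assoc a 0 0)) (trans h (+-comm 1 a)))) λ ()

module _ {D R o : Bool} {u l d r : ℕ} {s s′ : Sides} {c : ℕ} where
  open Sides s using () renaming (top to t; bottom to b; left to le; right to ri)
  open Sides s′ using () renaming (top to t′; bottom to b′; left to le′; right to ri′)

  -- A flippable pattern means equal rises from above and from the left and the opposite rise on the
  -- way out, so the neighbours are extremal. Flipping all sides exchanges the rises on the two
  -- sides of the square and fits the same neighbours.
  flipped-toggle : Around D R o u l d r s c → Flippable D R s → Flipped D R s s′ →
    Around D R o u l d r s′ (u + bit (t′ xor o)) × IsToggle D R u l d r c (u + bit (t′ xor o))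
  flipped-toggle (around fu fl td tr) (le≡ , b≡ , r≡) (t′≡ , le′≡ , b′≡ , r′≡) =
    around refl
      (cong₂ (λ a x → a + bit x) (sym l≡u) (trans (cong (_xor o) t′≡) (sym le′-x)))
      (λ D → trans (d≡ D) (trans (sym (v-suc)) (cong (λ x → v + bit x) (sym (b′-x D)))))
      (λ R → trans (r≡′ R) (trans (sym (v-suc)) (cong (λ x → v + bit x) (sym (r′-x R))))) ,
    (λ _ → c+v) ,
    (λ ¬e → contradiction (l≡u , d≡ , r≡′) ¬e)
    where
    x = t xor o
    v = u + bit (t′ xor o)

    t′-x : t′ xor o ≡ not x
    t′-x = trans (cong (_xor o) t′≡) (sym (not-distribˡ-xor t o))

    le-x : le xor not o ≡ x
    le-x = trans (cong (_xor not o) le≡) (xor-annihilates-not t o)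

    le′-x : le′ xor not o ≡ not t xor o
    le′-x = trans (cong (_xor not o) (trans le′≡ (cong not le≡))) (xor-annihilates-not (not t) o)

    l≡u : l ≡ u
    l≡u = +-cancelʳ-≡ (bit x) l u (trans (cong (λ y → l + bit y) (sym le-x)) (trans (sym fl) fu))

    c-suc : c + bit (not x) ≡ suc u
    c-suc = trans (cong (_+ bit (not x)) fu) (+bit+bit-not u x)

    v-suc : v + bit x ≡ suc u
    v-suc = trans (cong₂ (λ y z → u + bit y + bit z) t′-x (sym (not-involutive x))) (+bit+bit-not u (not x))

    d≡ : T D → d ≡ suc u
    d≡ D = trans (td D) (trans (cong (λ y → c + bit y)
      (trans (cong (_xor not o) (b≡ D)) (sym (not-distribʳ-xor t o)))) c-suc)

    r≡′ : T R → r ≡ suc u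
    r≡′ R = trans (tr R) (trans (cong (λ y → c + bit y)
      (trans (cong₂ _xor_ (r≡ R) (not-involutive o)) (sym (not-distribˡ-xor t o)))) c-suc)

    b′-x : T D → b′ xor not o ≡ x
    b′-x D = trans (cong (_xor not o) (trans (b′≡ D) (cong not (b≡ D)))) (xor-annihilates-not t o)

    r′-x : T R → ri′ xor not (not o) ≡ x
    r′-x R = cong₂ _xor_ (trans (r′≡ R) (trans (cong not (r≡ R)) (not-involutive t))) (not-involutive o)

    c+v : c + v ≡ suc (u + u)
    c+v = begin
      c + (u + bit (t′ xor o))   ≡⟨ cong (λ y → c + (u + bit y)) t′-x ⟩
      c + (u + bit (not x))      ≡⟨ cong (c +_) (+-comm u (bit (not x))) ⟩
      c + (bit (not x) + u)      ≡⟨ +-assoc c (bit (not x)) u ⟨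
      c + bit (not x) + u        ≡⟨ cong (_+ u) c-suc ⟩
      suc (u + u)                ∎
      where open ≡-Reasoning

  -- By contraposition: extremal neighbours determine every rise from the one above, and these rises
  -- spell out a flippable pattern.
  unchanged-toggle : Around D R o u l d r s c → ¬ Flippable D R s → Unchanged s s′ →
    Around D R o u l d r s′ (u + bit (t′ xor o)) × IsToggle D R u l d r c (u + bit (t′ xor o))
  unchanged-toggle A@(around fu fl td tr) ¬flip (refl , refl , refl , refl) =
    subst (Around D R o u l d r s) fu A ,
    (λ (l≡u , d≡ , r≡) → contradiction
      (le≡ l≡u , (λ D → b≡ (d≡ D) (td D)) , (λ R → r≡′ (r≡ R) (tr R))) ¬flip) ,
    (λ _ → sym fu)
    where
    le≡ : l ≡ u → le ≡ not t
    le≡ refl = xor-cancelʳ (not o) (trans (bit-injective (+-cancelˡ-≡ l _ _ (trans (sym fl) fu)))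
      (sym (xor-annihilates-not t o)))

    complement : ∀ {e} y → e ≡ suc u → e ≡ c + bit y → y ≡ not (t xor o)
    complement y e≡ e≡′ = +bit+bit≡1+⇒not u (t xor o) y
      (trans (cong (_+ bit y) (sym fu)) (trans (sym e≡′) e≡))

    b≡ : d ≡ suc u → d ≡ c + bit (b xor not o) → b ≡ t
    b≡ e e′ = xor-cancelʳ (not o) (trans (complement _ e e′) (not-distribʳ-xor t o))

    r≡′ : r ≡ suc u → r ≡ c + bit (ri xor not (not o)) → ri ≡ not t
    r≡′ e e′ = xor-cancelʳ o (trans (cong (ri xor_) (sym (not-involutive o)))
      (trans (complement _ e e′) (not-distribˡ-xor t o)))

hasVert-outside : ∀ (F : Subgraph m n) i j → ¬ j ≤ n → hasVert F i j ≡ false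
hasVert-outside {m} {n} F i j j≰n with i ≤? m ×-dec 1 ≤? j ×-dec j ≤? n
... | yes (_ , _ , j≤n) = contradiction j≤n j≰n
... | no _ = refl

hasHoriz-outside : ∀ (F : Subgraph m n) i j → ¬ i ≤ m → hasHoriz F i j ≡ false
hasHoriz-outside {m} {n} F i j i≰m with 1 ≤? i ×-dec i ≤? m ×-dec j ≤? n
... | yes (_ , i≤m , _) = contradiction i≤m i≰m
... | no _ = refl

∧-absorb : ∀ a b → (¬ T a → b ≡ false) → a ∧ b ≡ b
∧-absorb true  b _ = refl
∧-absorb false b h = sym (h id)

-- A single rise after one square has received height `v`: `X` says that the step enters this
-- square, `Y` that it leaves it, with `t` and `b` the new values of the edge crossed.
if-step : ∀ X Y {v x y w e t b} →
  (T X → ¬ T Y) →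
  (T X → v ≡ x + bit (t xor w)) → (T Y → y ≡ v + bit (b xor w)) → y ≡ x + bit (e xor w) →
  (if X then v else y) ≡ (if Y then v else x) + bit ((if X then t else if Y then b else e) xor w)
if-step true  true  disjoint _ _ _ = contradiction _ (disjoint _)
if-step true  false _ h _ _ = h _
if-step false true  _ _ h _ = h _
if-step false false _ _ _ h = h

at : ∀ a b i j → T ((a ≡ᵇ i) ∧ (b ≡ᵇ j)) → a ≡ i × b ≡ j
at a b i j h = let (p , q) = Equivalence.to Bool.T-∧ h in ≡ᵇ⇒≡ a i p , ≡ᵇ⇒≡ b j q

At : ℕ → ℕ → Square m n → Set
At i j Q = i ≡ Square.row Q × j ≡ Square.col Q

update : ℕ → ℕ → ℕ → Height → Height
update i j v c a b = if (a ≡ᵇ i) ∧ (b ≡ᵇ j) then v else c a b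

update-at : ∀ i j v c → update i j v c i j ≡ v
update-at i j v c with (i ≡ᵇ i) ∧ (j ≡ᵇ j) | Equivalence.from Bool.T-∧ (≡⇒≡ᵇ i i refl , ≡⇒≡ᵇ j j refl)
... | true | _ = refl

update-elsewhere : ∀ i j v c a b → ¬ (a ≡ i × b ≡ j) → update i j v c a b ≡ c a b
update-elsewhere i j v c a b ¬at with (a ≡ᵇ i) ∧ (b ≡ᵇ j) | at a b i j
... | true  | h = contradiction (h _) ¬at
... | false | _ = refl

-- The squares below the last row and right of the last column do not take part.
ToggledAt : ℕ → ℕ → Height → ℕ → ℕ → ℕ → Set
ToggledAt m n c i j v = IsToggle (suc i <ᵇ m) (suc j <ᵇ n)
  (c i (suc j)) (c (suc i) j) (c (suc (suc i)) (suc j)) (c (suc i) (suc (suc j))) (c (suc i) (suc j)) v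

module _ {F : Subgraph m n} {c : Height} (Rep : Represents F c) where
  private module R = Represents Rep

  module _ {i j} (i<m : i < m) (j<n : j < n) where
    private
      Q : Square m n
      Q = square (suc i) (suc j) i<m j<n

      D R o : Bool
      D = suc i <ᵇ m
      R = suc j <ᵇ n
      o = odd (i + suc j)

      s s′ : Sides
      s  = sides F Q
      s′ = swap (kind Q) s

      open Sides s using () renaming (top to t; bottom to b; left to le; right to ri)

      u l d r v : ℕ
      u = c i (suc j)
      l = c (suc i) j
      d = c (suc (suc i)) (suc j)
      r = c (suc i) (suc (suc j))
      v = u + bit (Sides.top s′ xor o)

      o≡ : odd (suc i + j) ≡ o
      o≡ = sym (odd-+suc i j)

      around-old : Around D R o u l d r s (c (suc i) (suc j))
      around-old = around
        (R.down i (suc j) i<m j<n)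
        (trans (R.right (suc i) j i<m j<n) (cong (λ x → l + bit (le xor not x)) o≡))
        (λ h → R.down (suc i) (suc j) (<ᵇ⇒< _ _ h) j<n)
        (λ h → R.right (suc i) (suc j) i<m (<ᵇ⇒< _ _ h))

      s-masked : s ≡ ⟨T t ,B D ∧ b ,L le ,R R ∧ ri ⟩
      s-masked = cong₂ (λ x y → ⟨T t ,B x ,L le ,R y ⟩)
        (sym (∧-absorb D b λ ¬D → hasHoriz-outside F (suc (suc i)) (suc j) (¬D ∘ <⇒<ᵇ)))
        (sym (∧-absorb R ri λ ¬R → hasVert-outside F (suc i) (suc (suc j)) (¬R ∘ <⇒<ᵇ)))

      around-new×toggle : Around D R o u l d r s′ v × IsToggle D R u l d r (c (suc i) (suc j)) v
      around-new×toggle = by-cases (flippable? D R s)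
        where
        by-cases : Dec (Flippable D R s) → _
        by-cases (yes f) = flipped-toggle around-old f
          (subst (λ s → Flipped D R s (swap (kindOf D R) s)) (sym s-masked)
            (swap-flips D R t b le ri (subst (Flippable D R) s-masked f)))
        by-cases (no ¬f) = unchanged-toggle around-old ¬f
          (subst (λ s → Unchanged s (swap (kindOf D R) s)) (sym s-masked)
            (swap-fixes D R t b le ri (¬f ∘ subst (Flippable D R) (sym s-masked))))

      module N = Around (proj₁ around-new×toggle)

      c′ : Height
      c′ = update (suc i) (suc j) v c

      F′ : Subgraph m n
      F′ = localSubgraph Q F

      represents-update : Represents F′ c′
      represents-update = record
        { top   = λ _ → R.top _
        ; left  = λ a a≤m → trans (update-elsewhere (suc i) (suc j) v c a 0 λ ()) (R.left a a≤m)
        ; right = right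
        ; down  = down
        }
        where
        down : ∀ a b → a < m → b ≤ n → c′ (suc a) b ≡ c′ a b + riseDown F′ a b
        down a b a<m b≤n = trans
          (if-step ((a ≡ᵇ i) ∧ (b ≡ᵇ suc j)) ((a ≡ᵇ suc i) ∧ (b ≡ᵇ suc j))
            (λ h h′ → contradiction (trans (sym (proj₁ (at a b (suc i) (suc j) h′))) (proj₁ (at a b i (suc j) h))) 1+n≢n)
            (λ h → enter (at a b i (suc j) h))
            (λ h → leave (at a b (suc i) (suc j) h))
            (R.down a b a<m b≤n))
          (cong (λ e → c′ a b + bit (e xor odd (a + b))) (sym edge))
          where
          enter : a ≡ i × b ≡ suc j → v ≡ c a b + bit (Sides.top s′ xor odd (a + b))
          enter (refl , refl) = refl

          leave : a ≡ suc i × b ≡ suc j → c (suc a) b ≡ v + bit (Sides.bottom s′ xor odd (a + b))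
          leave (refl , refl) = N.to-down (<⇒<ᵇ a<m)

          edge : hasHoriz F′ (suc a) b ≡
            (if (a ≡ᵇ i) ∧ (b ≡ᵇ suc j) then Sides.top s′ else
             if (a ≡ᵇ suc i) ∧ (b ≡ᵇ suc j) then Sides.bottom s′ else hasHoriz F (suc a) b)
          edge = trans (hasHoriz-edge F′ (suc a) b (s≤s z≤n) a<m b≤n)
            (cong (λ e → if (a ≡ᵇ i) ∧ (b ≡ᵇ suc j) then Sides.top s′ else
                         if (a ≡ᵇ suc i) ∧ (b ≡ᵇ suc j) then Sides.bottom s′ else e)
              (sym (hasHoriz-edge F (suc a) b (s≤s z≤n) a<m b≤n)))

        right : ∀ a b → a ≤ m → b < n → c′ a (suc b) ≡ c′ a b + riseRight F′ a b
        right a b a≤m b<n = trans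
          (if-step ((a ≡ᵇ suc i) ∧ (b ≡ᵇ j)) ((a ≡ᵇ suc i) ∧ (b ≡ᵇ suc j))
            (λ h h′ → contradiction (trans (sym (proj₂ (at a b (suc i) (suc j) h′))) (proj₂ (at a b (suc i) j h))) 1+n≢n)
            (λ h → enter (at a b (suc i) j h))
            (λ h → leave (at a b (suc i) (suc j) h))
            (R.right a b a≤m b<n))
          (cong (λ e → c′ a b + bit (e xor not (odd (a + b)))) (sym edge))
          where
          enter : a ≡ suc i × b ≡ j → v ≡ c a b + bit (Sides.left s′ xor not (odd (a + b)))
          enter (refl , refl) =
            trans N.from-left (cong (λ x → l + bit (Sides.left s′ xor not x)) (sym o≡))

          leave : a ≡ suc i × b ≡ suc j → c a (suc b) ≡ v + bit (Sides.right s′ xor not (odd (a + b)))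
          leave (refl , refl) = N.to-right (<⇒<ᵇ b<n)

          edge : hasVert F′ a (suc b) ≡
            (if (a ≡ᵇ suc i) ∧ (b ≡ᵇ j) then Sides.left s′ else
             if (a ≡ᵇ suc i) ∧ (b ≡ᵇ suc j) then Sides.right s′ else hasVert F a (suc b))
          edge = trans (hasVert-edge F′ a (suc b) a≤m (s≤s z≤n) b<n)
            (cong (λ e → if (a ≡ᵇ suc i) ∧ (b ≡ᵇ j) then Sides.left s′ else
                         if (a ≡ᵇ suc i) ∧ (b ≡ᵇ suc j) then Sides.right s′ else e)
              (sym (hasVert-edge F a (suc b) a≤m (s≤s z≤n) b<n)))

    local-represents : Represents (localSubgraph Q F) c′
    local-represents = represents-update

    local-toggledAt : ToggledAt m n c i j (c′ (suc i) (suc j))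
    local-toggledAt = subst (ToggledAt m n c i j) (sym (update-at (suc i) (suc j) v c))
      (proj₂ around-new×toggle)

-- Serves the boundary squares, where the local action writes back the sides it has read.
setSides-sides : ∀ (Q : Square m n) (F : Subgraph m n) e → setSides Q (sides F Q) F e ≡ F e
setSides-sides (square i j _ _) F (vert a b p q r)
  with (a ≡ᵇ i) ∧ (b ≡ᵇ j) | at a b i j | (a ≡ᵇ i) ∧ (b ≡ᵇ suc j) | at a b i (suc j)
... | true  | h | _     | _ with refl , refl ← h _ = hasVert-edge F a b p q r
... | false | _ | true  | h with refl , refl ← h _ = hasVert-edge F a b p q r
... | false | _ | false | _ = refl
setSides-sides (square i j _ _) F (horiz a b p q r)
  with (a ≡ᵇ i) ∧ (b ≡ᵇ j) | at a b i j | (a ≡ᵇ suc i) ∧ (b ≡ᵇ j) | at a b (suc i) j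
... | true  | h | _     | _ with refl , refl ← h _ = hasHoriz-edge F a b p q r
... | false | _ | true  | h with refl , refl ← h _ = hasHoriz-edge F a b p q r
... | false | _ | false | _ = refl

represents-resp : ∀ {F F′ : Subgraph m n} {c} → (∀ e → F e ≡ F′ e) → Represents F c → Represents F′ c
represents-resp {F′ = F′} {c} eq Rep = record
  { top   = R.top
  ; left  = R.left
  ; right = λ i j p q → trans (R.right i j p q)
      (cong (λ e → c i j + bit (e xor not (odd (i + j)))) (hasVert-cong {F′ = F′} eq i (suc j)))
  ; down  = λ i j p q → trans (R.down i j p q)
      (cong (λ e → c i j + bit (e xor odd (i + j))) (hasHoriz-cong {F′ = F′} eq (suc i) j))
  }
  where module R = Represents Rep

local-elsewhere : ∀ (Q : Square m n) {F : Subgraph m n} {c c′} →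
  Represents F c → Represents (localSubgraph Q F) c′ →
  ∀ i j → i ≤ m → j ≤ n → ¬ At i j Q → c′ i j ≡ c i j
local-elsewhere Q@(square zero _ _ _) {F} R R′ i j p q _ =
  represents-unique R′ (represents-resp (sym ∘ setSides-sides Q F) R) i j p q
local-elsewhere Q@(square (suc _) zero _ _) {F} R R′ i j p q _ =
  represents-unique R′ (represents-resp (sym ∘ setSides-sides Q F) R) i j p q
local-elsewhere (square (suc a) (suc b) a<m b<n) {c = c} R R′ i j p q ¬at =
  trans (represents-unique R′ (local-represents R (recompute (_ <? _) a<m) (recompute (_ <? _) b<n)) i j p q)
    (update-elsewhere (suc a) (suc b) _ c i j ¬at)

local-at : ∀ (Q : Square m n) {F : Subgraph m n} {c c′} →
  Represents F c → Represents (localSubgraph Q F) c′ →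
  ∀ i j → i < m → j < n → At (suc i) (suc j) Q → ToggledAt m n c i j (c′ (suc i) (suc j))
local-at {m} {n} Q {c = c} R R′ i j i<m j<n (refl , refl) =
  subst (ToggledAt m n c i j)
    (represents-unique (local-represents R i<m j<n) R′ (suc i) (suc j) i<m j<n)
    (local-toggledAt R i<m j<n)

isToggle-resp : ∀ {D R u u′ l l′ d d′ r r′ c c′ v} → u ≡ u′ → l ≡ l′ →
  (T D → d ≡ d′) → (T R → r ≡ r′) → c ≡ c′ →
  IsToggle D R u l d r c v → IsToggle D R u′ l′ d′ r′ c′ v
isToggle-resp refl refl d≡ r≡ refl (yes′ , no′) =
  (λ (e , f , g) → yes′ (e , (λ D → trans (d≡ D) (f D)) , (λ R → trans (r≡ R) (g R)))) ,
  (λ ¬e → no′ λ (e , f , g) → ¬e (e , (λ D → trans (sym (d≡ D)) (f D)) , (λ R → trans (sym (r≡ R)) (g R))))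

-- A pass over the squares of one parity

heightAfter : List (Square m n) → PFPL m n → Height
heightAfter L F = pfplHeight (foldr localAction F L)

OfParity : Parity → Square m n → Set
OfParity π Q = parity (Square.row Q + Square.col Q) ≡ π

at-parity : ∀ {π} {L : List (Square m n)} {i j} → All (OfParity π) L → Any (At i j) L → parity (i + j) ≡ π
at-parity (Qπ ∷ _) (here (refl , refl)) = Qπ
at-parity (_ ∷ Lπ) (there ∈L)           = at-parity Lπ ∈L

at-unique : ∀ {Q : Square m n} {L i j} → All (Q ≢_) L → At i j Q → ¬ Any (At i j) L
at-unique (Q≢ ∷ _)  (refl , refl) (here (refl , refl)) = Q≢ refl
at-unique (_ ∷ Q∉L) at-Q          (there ∈L)           = at-unique Q∉L at-Q ∈L

module _ (F : PFPL m n) where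

  elsewhere : ∀ L i j → i ≤ m → j ≤ n → ¬ Any (At i j) L → heightAfter L F i j ≡ pfplHeight F i j
  elsewhere []      i j _ _ _  = refl
  elsewhere (Q ∷ L) i j p q ¬∈ = trans
    (local-elsewhere Q (represents (foldr localAction F L)) (represents (foldr localAction F (Q ∷ L))) i j p q (¬∈ ∘ here))
    (elsewhere L i j p q (¬∈ ∘ there))

  -- Squares of equal parity are not adjacent, so the neighbours of a square in L keep their height.
  toggled : ∀ {π} L → Unique L → All (OfParity π) L → ∀ i j → i < m → j < n → Any (At (suc i) (suc j)) L →
    ToggledAt m n (pfplHeight F) i j (heightAfter L F (suc i) (suc j))
  toggled (Q ∷ L) (Q∉L ∷ unique) (_ ∷ Lπ) i j i<m j<n (there ∈L) =
    subst (ToggledAt m n (pfplHeight F) i j)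
      (sym (local-elsewhere Q (represents (foldr localAction F L)) (represents (foldr localAction F (Q ∷ L)))
        (suc i) (suc j) i<m j<n (λ at-Q → at-unique Q∉L at-Q ∈L)))
      (toggled L unique Lπ i j i<m j<n ∈L)
  toggled (Q ∷ L) (Q∉L ∷ _) (Qπ ∷ Lπ) i j i<m j<n (here at-Q@(refl , refl)) =
    isToggle-resp
      (same i (suc j) (<⇒≤ i<m) j<n (λ h → parity-suc (i + suc j) (trans Qπ (sym h))))
      (same (suc i) j i<m (<⇒≤ j<n) (λ h → parity-suc (suc i + j) (trans (trans (cong (parity ∘ suc) (sym (+-suc i j))) Qπ) (sym h))))
      (λ D → same (suc (suc i)) (suc j) (<ᵇ⇒< _ _ D) j<n (λ h → parity-suc (suc i + suc j) (trans h (sym Qπ))))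
      (λ R → same (suc i) (suc (suc j)) i<m (<ᵇ⇒< _ _ R)
        (λ h → parity-suc (suc i + suc j) (trans (trans (cong (parity ∘ suc) (sym (+-suc i (suc j)))) h) (sym Qπ))))
      (elsewhere L (suc i) (suc j) i<m j<n (at-unique Q∉L at-Q))
      (local-at Q (represents (foldr localAction F L)) (represents (foldr localAction F (Q ∷ L))) i j i<m j<n at-Q)
    where
    same : ∀ a b → a ≤ m → b ≤ n → parity (a + b) ≢ _ → heightAfter L F a b ≡ pfplHeight F a b
    same a b p q ≢π = elsewhere L a b p q λ ∈L → ≢π (at-parity Lπ ∈L)

hasParity? : ∀ π → Decidable (OfParity {m} {n} π)
hasParity? π Q = parity (Square.row Q + Square.col Q) Parity.≟ π

squareAt : Fin (suc m) → Fin (suc n) → Square m n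
squareAt i j = square (toℕ i) (toℕ j) (s≤s⁻¹ (Fin.toℕ<n i)) (s≤s⁻¹ (Fin.toℕ<n j))

at∈squaresOfParity : ∀ π i j → i ≤ m → j ≤ n → parity (i + j) ≡ π → Any (At i j) (squaresOfParity {m} {n} π)
at∈squaresOfParity {m} {n} π i j i≤m j≤n h = lose
  (∈-filter⁺ (hasParity? π)
    (∈-cartesianProductWith⁺ squareAt (∈-allFin (fromℕ< (s≤s i≤m))) (∈-allFin (fromℕ< (s≤s j≤n))))
    (trans (cong parity (cong₂ _+_ (Fin.toℕ-fromℕ< (s≤s i≤m)) (Fin.toℕ-fromℕ< (s≤s j≤n)))) h))
  (sym (Fin.toℕ-fromℕ< (s≤s i≤m)) , sym (Fin.toℕ-fromℕ< (s≤s j≤n)))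

squaresOfParity-parity : ∀ π → All (OfParity π) (squaresOfParity {m} {n} π)
squaresOfParity-parity {m} {n} π = All.tabulate λ Q∈ →
  proj₂ (∈-filter⁻ (hasParity? π) {xs = allSquares m n} Q∈)

squaresOfParity-unique : ∀ π → Unique (squaresOfParity {m} {n} π)
squaresOfParity-unique {m} {n} π = filter⁺ (hasParity? π) (cartesianProductWith⁺ squareAt
  (λ eq → Fin.toℕ-injective (cong Square.row eq) , Fin.toℕ-injective (cong Square.col eq))
  (allFin⁺ (suc m)) (allFin⁺ (suc n)))

-- Toggling heights toggles order ideals

module _ {c : Height} (h : IsHeight m n c) (i j k : ℕ)
  (k<m : k < m) (k≤j : k ≤ j) (j<n : j < n) (k≤i : k ≤ i) (i<m : i < m) where
  private
    p : Element m n
    p = element i j k k<m k≤j j<n k≤i i<m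

    Near : Set
    Near = Extremal (suc i <ᵇ m) (suc j <ᵇ n)
      (c i (suc j)) (c (suc i) j) (c (suc (suc i)) (suc j)) (c (suc i) (suc (suc j)))

  -- Each neighbouring height is pinned by two covers of `p`, one below giving a lower bound and one
  -- above giving an upper bound. Where such a cover leaves the poset, nonnegativity, the zero
  -- boundary or `height≤row` and `height≤col` provide the inequality.
  toggleable⇒extremal : Toggleable (ideal c h) p → Near × c i (suc j) ≡ k
  toggleable⇒extremal (lower , upper) = (trans left≡k (sym up≡k) , down≡ , right≡) , up≡k
    where
    lowerᵏ : ∀ i′ j′ k′ → .(a : k′ < m) .(b : k′ ≤ j′) .(c₁ : j′ < n) .(d : k′ ≤ i′) .(e : i′ < m) →
      p covers element i′ j′ k′ a b c₁ d e → k′ < c (suc i′) (suc j′)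
    lowerᵏ i′ j′ k′ a b c₁ d e p⋗q = <ᵇ⇒< _ _ (lower (element i′ j′ k′ a b c₁ d e) p⋗q)

    upperᵏ : ∀ i′ j′ k′ → .(a : k′ < m) .(b : k′ ≤ j′) .(c₁ : j′ < n) .(d : k′ ≤ i′) .(e : i′ < m) →
      element i′ j′ k′ a b c₁ d e covers p → c (suc i′) (suc j′) ≤ k′
    upperᵏ i′ j′ k′ a b c₁ d e q⋗p = ≮⇒≥ (upper (element i′ j′ k′ a b c₁ d e) q⋗p ∘ <⇒<ᵇ)

    up≥ : ∀ i k → i < m → k ≤ i → (∀ i′ k′ → i ≡ suc i′ → k ≡ suc k′ → k′ < c (suc i′) (suc j)) → k ≤ c i (suc j)
    up≥ i       zero    _ _ _ = z≤n
    up≥ (suc i) (suc k) _ _ f = f i k refl refl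

    up≤ : ∀ i → i < m → (∀ i′ → i ≡ suc i′ → k ≤ i′ → c (suc i′) (suc j) ≤ k) → c i (suc j) ≤ k
    up≤ zero    _   _ = ≤-trans (≤-reflexive (IsHeight.top h (suc j) j<n)) z≤n
    up≤ (suc i) i<m f = ≮⇒≥ λ k<c →
      <⇒≱ k<c (f i refl (s≤s⁻¹ (<-≤-trans k<c (height≤row h (suc i) (suc j) (<⇒≤ i<m) j<n))))

    left≥ : ∀ j k → j < n → k ≤ j → (∀ j′ k′ → j ≡ suc j′ → k ≡ suc k′ → k′ < c (suc i) (suc j′)) → k ≤ c (suc i) j
    left≥ j       zero    _ _ _ = z≤n
    left≥ (suc j) (suc k) _ _ f = f j k refl refl

    left≤ : ∀ j → j < n → (∀ j′ → j ≡ suc j′ → k ≤ j′ → c (suc i) (suc j′) ≤ k) → c (suc i) j ≤ k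
    left≤ zero    _   _ = ≤-trans (≤-reflexive (IsHeight.left h (suc i) i<m)) z≤n
    left≤ (suc j) j<n f = ≮⇒≥ λ k<c →
      <⇒≱ k<c (f j refl (s≤s⁻¹ (<-≤-trans k<c (height≤col h (suc i) (suc j) i<m (<⇒≤ j<n)))))

    up≡k : c i (suc j) ≡ k
    up≡k = ≤-antisym
      (up≤ i i<m λ { i′ refl k≤i′ → upperᵏ i′ j k k<m k≤j j<n k≤i′ (<⇒≤ i<m) (down-i refl refl refl) })
      (up≥ i k i<m k≤i λ { i′ k′ refl refl →
        lowerᵏ i′ j k′ (<⇒≤ k<m) (<⇒≤ k≤j) j<n (s≤s⁻¹ k≤i) (<⇒≤ i<m) (down-ik refl refl refl) })

    left≡k : c (suc i) j ≡ k
    left≡k = ≤-antisym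
      (left≤ j j<n λ { j′ refl k≤j′ → upperᵏ i j′ k k<m k≤j′ (<⇒≤ j<n) k≤i i<m (down-j refl refl refl) })
      (left≥ j k j<n k≤j λ { j′ k′ refl refl →
        lowerᵏ i j′ k′ (<⇒≤ k<m) (s≤s⁻¹ k≤j) (<⇒≤ j<n) (<⇒≤ k≤i) i<m (down-jk refl refl refl) })

    down≡ : T (suc i <ᵇ m) → c (suc (suc i)) (suc j) ≡ suc (c i (suc j))
    down≡ D = trans (≤-antisym below (lowerᵏ (suc i) j k k<m k≤j j<n (m≤n⇒m≤1+n k≤i) i+1<m (down-i refl refl refl)))
      (cong suc (sym up≡k))
      where
      i+1<m = <ᵇ⇒< (suc i) m D

      below : c (suc (suc i)) (suc j) ≤ suc k
      below = ≮⇒≥ λ k<c → <⇒≱ k<c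
        (upperᵏ (suc i) j (suc k) (≤-<-trans (s≤s k≤i) i+1<m)
          (s≤s⁻¹ (<-≤-trans k<c (height≤col h (suc (suc i)) (suc j) i+1<m j<n))) j<n (s≤s k≤i) i+1<m
          (down-ik refl refl refl))

    right≡ : T (suc j <ᵇ n) → c (suc i) (suc (suc j)) ≡ suc (c i (suc j))
    right≡ R = trans (≤-antisym below (lowerᵏ i (suc j) k k<m (m≤n⇒m≤1+n k≤j) j+1<n k≤i i<m (down-j refl refl refl)))
      (cong suc (sym up≡k))
      where
      j+1<n = <ᵇ⇒< (suc j) n R

      below : c (suc i) (suc (suc j)) ≤ suc k
      below = ≮⇒≥ λ k<c →
        let k<i = s≤s⁻¹ (<-≤-trans k<c (height≤row h (suc i) (suc (suc j)) i<m j+1<n)) in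
        <⇒≱ k<c (upperᵏ i (suc j) (suc k) (≤-<-trans k<i i<m) (s≤s k≤j) j+1<n k<i i<m (down-jk refl refl refl))

  extremal⇒toggleable : Near → c i (suc j) ≡ k → Toggleable (ideal c h) p
  extremal⇒toggleable (left≡ , down≡ , right≡) up≡k = (λ q → lower {q}) , (λ q → upper {q})
    where
    lower : ∀ {q} → p covers q → T (member (ideal c h) q)
    lower {element _ _ _ _ _ _ _ i+1<m} (down-i refl refl refl) =
      <⇒<ᵇ (≤-reflexive (trans (cong suc (sym up≡k)) (sym (down≡ (<⇒<ᵇ (recompute (_ <? _) i+1<m))))))
    lower {element _ _ _ _ _ j+1<n _ _} (down-j refl refl refl) =
      <⇒<ᵇ (≤-reflexive (trans (cong suc (sym up≡k)) (sym (right≡ (<⇒<ᵇ (recompute (_ <? _) j+1<n))))))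
    lower {element _ _ _ _ _ _ _ _} (down-ik refl refl refl) = <⇒<ᵇ (≤-reflexive (sym up≡k))
    lower {element _ _ _ _ _ _ _ _} (down-jk refl refl refl) = <⇒<ᵇ (≤-reflexive (sym (trans left≡ up≡k)))

    upper : ∀ {q} → q covers p → ¬ T (member (ideal c h) q)
    upper {element _ _ _ _ _ _ _ _} (down-i refl refl refl) x = <⇒≱ (<ᵇ⇒< _ _ x) (≤-reflexive up≡k)
    upper {element _ _ _ _ _ _ _ _} (down-j refl refl refl) x = <⇒≱ (<ᵇ⇒< _ _ x) (≤-reflexive (trans left≡ up≡k))
    upper {element _ _ _ _ _ _ _ i+1<m} (down-ik refl refl refl) x = <⇒≱ (<ᵇ⇒< _ _ x)
      (≤-reflexive (trans (down≡ (<⇒<ᵇ (recompute (_ <? _) i+1<m))) (cong suc up≡k)))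
    upper {element _ _ _ _ _ j+1<n _ _} (down-jk refl refl refl) x = <⇒≱ (<ᵇ⇒< _ _ x)
      (≤-reflexive (trans (right≡ (<⇒<ᵇ (recompute (_ <? _) j+1<n))) (cong suc up≡k)))

-- Passing between heights `u` and `suc u` affects only the element with `k` equal to `u`; hence a
-- height toggle moves at most one element over each `(i, j)`.
<ᵇ-far : ∀ k u x y → k ≢ u → (k <ᵇ u + bit x) ≡ (k <ᵇ u + bit y)
<ᵇ-far zero    zero    x y k≢u = contradiction refl k≢u
<ᵇ-far zero    (suc u) x y _   = refl
<ᵇ-far (suc k) zero    x y _   = trans (outside k x) (sym (outside k y))
  where
  outside : ∀ k x → (suc k <ᵇ bit x) ≡ false
  outside k true  = refl
  outside k false = refl
<ᵇ-far (suc k) (suc u) x y k≢u = <ᵇ-far k u x y (k≢u ∘ cong suc)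

module _ {D R u l d r c v} (tog : IsToggle D R u l d r c v) (step : ∃ λ x → c ≡ u + bit x) where
  private
    x = proj₁ step

    flipped : Extremal D R u l d r → v ≡ u + bit (not x)
    flipped e = +-cancelˡ-≡ c v (u + bit (not x)) (trans (proj₁ tog e) (sym (begin
      c + (u + bit (not x))          ≡⟨ cong (_+ (u + bit (not x))) (proj₂ step) ⟩
      (u + bit x) + (u + bit (not x)) ≡⟨ cong ((u + bit x) +_) (+-comm u _) ⟩
      (u + bit x) + (bit (not x) + u) ≡⟨ +-assoc (u + bit x) _ u ⟨
      (u + bit x) + bit (not x) + u   ≡⟨ cong (_+ u) (+bit+bit-not u x) ⟩
      suc (u + u)                     ∎)))
      where open ≡-Reasoning

  <ᵇ-toggle-yes : Extremal D R u l d r → (u <ᵇ v) ≡ not (u <ᵇ c)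
  <ᵇ-toggle-yes e = begin
    u <ᵇ v                 ≡⟨ cong (u <ᵇ_) (flipped e) ⟩
    u <ᵇ u + bit (not x)   ≡⟨ m<ᵇm+bit u (not x) ⟩
    not x                  ≡⟨ cong not (m<ᵇm+bit u x) ⟨
    not (u <ᵇ u + bit x)   ≡⟨ cong (λ a → not (u <ᵇ a)) (proj₂ step) ⟨
    not (u <ᵇ c)           ∎
    where open ≡-Reasoning

  <ᵇ-toggle-no : ∀ {k} → ¬ (Extremal D R u l d r × u ≡ k) → (k <ᵇ v) ≡ (k <ᵇ c)
  <ᵇ-toggle-no {k} ¬e = by-cases extremal?
    where
    extremal? : Dec (Extremal D R u l d r)
    extremal? = l ≟ u ×-dec (T? D →-dec d ≟ suc u) ×-dec (T? R →-dec r ≟ suc u)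

    by-cases : Dec (Extremal D R u l d r) → (k <ᵇ v) ≡ (k <ᵇ c)
    by-cases (no ¬e′) = cong (k <ᵇ_) (proj₂ tog ¬e′)
    by-cases (yes e)  = trans (cong (k <ᵇ_) (flipped e))
      (trans (<ᵇ-far k u (not x) x (λ k≡u → ¬e (e , sym k≡u))) (cong (k <ᵇ_) (sym (proj₂ step))))

-- Gyration as toggling

encode-applyAll : ∀ π (F : PFPL m n) → encode (applyAll π F) ≈ toggleParity π (encode F)
encode-applyAll {m} {n} π F p@(element i j k k<m′ k≤j′ j<n′ k≤i′ i<m′) =
  by-cases (parity (i + j) Parity.≟ π) (toggleable? (encode F) p)
  where
  k<m = recompute (k <? m) k<m′
  k≤j = recompute (k ≤? j) k≤j′
  j<n = recompute (j <? n) j<n′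
  k≤i = recompute (k ≤? i) k≤i′
  i<m = recompute (i <? m) i<m′

  L : List (Square m n)
  L = squaresOfParity π

  S : IndependentSet m n
  S = parityClass m n π

  tog : parity (i + j) ≡ π → ToggledAt m n (pfplHeight F) i j (heightAfter L F (suc i) (suc j))
  tog h = toggled F L (squaresOfParity-unique π) (squaresOfParity-parity π) i j i<m j<n
    -- Both coordinates of the square are shifted by one, so its parity is that of `i + j`.
    (at∈squaresOfParity π (suc i) (suc j) i<m j<n (trans (cong (parity ∘ suc) (+-suc i j)) h))

  step : ∃ λ x → pfplHeight F (suc i) (suc j) ≡ pfplHeight F i (suc j) + bit x
  step = IsHeight.down (isHeight F) i (suc j) i<m j<n

  by-cases : Dec (parity (i + j) ≡ π) → Dec (Toggleable (encode F) p) →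
    member (encode (applyAll π F)) p ≡ toggleMember S (encode F) p
  by-cases (no ≢π) _ = trans
    (cong (k <ᵇ_) (elsewhere F L (suc i) (suc j) i<m j<n λ ∈L →
      ≢π (trans (cong (parity ∘ suc) (sym (+-suc i j))) (at-parity (squaresOfParity-parity π) ∈L))))
    (sym (toggleMember-no S (encode F) p (≢π ∘ proj₁)))
  by-cases (yes h) (yes t) =
    let (e , u≡k) = toggleable⇒extremal (isHeight F) i j k k<m k≤j j<n k≤i i<m t in
    trans (subst (λ k → (k <ᵇ heightAfter L F (suc i) (suc j)) ≡ not (k <ᵇ pfplHeight F (suc i) (suc j))) u≡k
        (<ᵇ-toggle-yes (tog h) step e))
      (sym (toggleMember-yes S (encode F) p h t))
  by-cases (yes h) (no ¬t) = trans
    (<ᵇ-toggle-no (tog h) step (λ (e , u≡k) →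
      ¬t (extremal⇒toggleable (isHeight F) i j k k<m k≤j j<n k≤i i<m e u≡k)))
    (sym (toggleMember-no S (encode F) p (¬t ∘ proj₂)))

-- Even squares before odd ones is the schedule of `evolve` at steps 0 and 1.
encode-gyration : (F : PFPL m n) → encode (gyration F) ≈ evolve 2 (encode F)
encode-gyration {m} {n} F p = trans (encode-applyAll 1ℙ (applyAll 0ℙ F) p)
  (toggle-cong (parityClass m n 1ℙ) {encode (applyAll 0ℙ F)} {toggleParity 0ℙ (encode F)}
    (encode-applyAll 0ℙ F) p)

theorem4p6 : (m n : ℕ) .{{_ : NonZero m}} .{{_ : NonZero n}} →
    Σ[ Φ ∈ Bijection (PFPL-setoid m n) (J-setoid m n) ]
    (∀ (F : PFPL m n) →
    Setoid._≈_ (J-setoid m n) (Bijection.to Φ (gyration F)) (rowmotion (Bijection.to Φ F)))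
theorem4p6 m n = Composition.bijection encode-bijection recombine , λ F p →
  trans (Bijection.cong recombine {encode (gyration F)} {evolve 2 (encode F)} (encode-gyration F) p)
    (rowmotion-recombined (encode F) p)
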